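{- Let $d \ge 3$ and $2 \le j \le d-1$ be integers. Then there exists an empty integral simplex $\mathcal{P}$ of dimension $d$ with $\mu_{\mathrm{va}}(\mathcal{P})=\mu_{\mathrm{midp}}(\mathcal{P})=\mu_{\mathrm{idp}}(\mathcal{P})=\mu_{\mathrm{Hilb}}(\mathcal{P})=\mu_{\mathrm{hole}}(\mathcal{P})=\mu_{\mathrm{Ehr}}(\mathcal{P})=j$.
   Context: An integral convex polytope $\mathcal{P}\subset\mathbb{R}^N$ has all vertices in $\mathbb{Z}^N$; a simplex $\mathcal{S}$ is empty if $\mathcal{S}\cap\mathbb{Z}^N$ is its vertex set. For $k \ge 1$, $k\mathcal{P} = \{k\alpha : \alpha \in \mathcal{P}\}$. An integral polytope $\mathcal{Q}$ has the integer decomposition property (IDP) if for every integer $k \geq 1$ and every $\alpha \in k\mathcal{Q} \cap \mathbb{Z}^N$ there are $\alpha_1,\dots,\alpha_k \in \mathcal{Q}\cap\mathbb{Z}^N$ with $\alpha = \alpha_1+\cdots+\alpha_k$; $\mathcal{Q}$ is very ample if this holds for all sufficiently large $k$. Let $\widetilde{\mathcal{P}} = \{(\alpha,1) : \alpha \in \mathcal{P}\}$, $\mathcal{C}(\mathcal{P})\subset\mathbb{R}^{N+1}$ the cone generated by the vertices of $\widetilde{\mathcal{P}}$, and the degree of $(\alpha,n)\in\mathcal{C}(\mathcal{P})\cap\mathbb{Z}^{N+1}$ is $n$; $\mathcal{H}(\mathcal{C}(\mathcal{P}))$ is its unique minimal Hilbert basis. For an empty simplex $\mathcal{S}$ with vertices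 $v_i$, $\mathrm{Box}(\mathcal{S}) = \{\sum_i r_i (v_i,1) \in \mathbb{Z}^{N+1} : 0 \le r_i < 1\}$; $\mathrm{Box}(\mathcal{P}) = \bigcup_{\mathcal{S}} \mathrm{Box}(\mathcal{S}) \setminus \mathbb{Z}_{\geq 0}(\widetilde{\mathcal{P}} \cap \mathbb{Z}^{N+1})$ over all empty $d$-dimensional integral simplices $\mathcal{S}\subset\mathcal{P}$. The $\delta$-vector $(\delta_0,\dots,\delta_d)$ is given by $\sum_{n\ge0}|n\mathcal{P}\cap\mathbb{Z}^N|t^n = (\sum_i \delta_i t^i)/(1-t)^{d+1}$. Invariants: $\mu_{\mathrm{va}}$ = least $k>0$ with $k\mathcal{P}$ very ample; $\mu_{\mathrm{midp}}$ = least $k>0$ with $k\mathcal{P}$ IDP; $\mu_{\mathrm{idp}}$ = least $k>0$ with $n\mathcal{P}$ IDP for all $n\ge k$; $\mu_{\mathrm{Hilb}}$ = maximal degree of elements of $\mathcal{H}(\mathcal{C}(\mathcal{P}))$; $\mu_{\mathrm{hole}}$ = maximal degree of elements of $\mathrm{Box}(\mathcal{P})$ (or $1$ if it is empty); $\mu_{\mathrm{Ehr}}$ = largest $i>0$ with $\delta_i\ne0$. -}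

module Defs where

open import Data.Nat as ℕ using (ℕ; zero; suc)
open import Data.Nat.Combinatorics using (_C_)
open import Data.Integer as ℤ using (ℤ; +_)
open import Data.Rational as ℚ using (ℚ; 0ℚ; 1ℚ)
open import Data.Fin using (Fin; zero; suc)
open import Data.Vec using (Vec; []; _∷_; zipWith; replicate; map) renaming (lookup to _!_)
open import Data.List using (List; length; lookup)
open import Data.List.Membership.Propositional using (_∈_)
open import Data.List.Relation.Unary.Unique.Propositional using (Unique)
open import Data.Product using (Σ; ∃; _×_; _,_)
open import Data.Sum using (_⊎_)
import Data.Unit
import Data.Fin
open import Relation.Binary.PropositionalEquality using (_≡_; _≢_)
open import Relation.Nullary using (¬_)
open import Function.Bundles using (_⇔_)

Pt : ℕ → Set
Pt N = Vec ℤ N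

Σℚ : (m : ℕ) → (Fin m → ℚ) → ℚ
Σℚ zero    f = 0ℚ
Σℚ (suc m) f = f zero ℚ.+ Σℚ m (λ i → f (suc i))

Σℤ : (m : ℕ) → (Fin m → ℤ) → ℤ
Σℤ zero    f = + 0
Σℤ (suc m) f = f zero ℤ.+ Σℤ m (λ i → f (suc i))

toℚ : ℤ → ℚ
toℚ z = z ℚ./ 1

ΣPt : ∀ {N} (m : ℕ) → (Fin m → Pt N) → Pt N
ΣPt {N} zero    f = replicate N (+ 0)
ΣPt     (suc m) f = zipWith ℤ._+_ (f zero) (ΣPt m (λ i → f (suc i)))

_·_ : ∀ {N} → ℤ → Pt N → Pt N
z · x = map (z ℤ.*_) x

CombEq : ∀ {N} (m : ℕ) → (Fin m → ℚ) → (Fin m → Pt N) → Pt N → Set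
CombEq {N} m λs v x =
  (c : Fin N) → Σℚ m (λ i → λs i ℚ.* toℚ (v i ! c)) ≡ toℚ (x ! c)

InDil : ∀ {N} (m : ℕ) → (Fin m → Pt N) → ℕ → Pt N → Set
InDil m v k x = Σ (Fin m → ℚ) λ λs →
  ((i : Fin m) → 0ℚ ℚ.≤ λs i) × (Σℚ m λs ≡ toℚ (+ k)) × CombEq m λs v x

InPoly : ∀ {N} (m : ℕ) → (Fin m → Pt N) → Pt N → Set
InPoly m v x = InDil m v 1 x

dilate : ∀ {N m} → ℕ → (Fin m → Pt N) → (Fin m → Pt N)
dilate k v i = (+ k) · v i

Decomposes : ∀ {N} (m : ℕ) → (Fin m → Pt N) → ℕ → Pt N → Set
Decomposes {N} m v n α = Σ (Fin n → Pt N) λ αs →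
  ((i : Fin n) → InPoly m v (αs i)) × (ΣPt n αs ≡ α)

IDP : ∀ {N} (m : ℕ) → (Fin m → Pt N) → Set
IDP {N} m v = (n : ℕ) → 1 ℕ.≤ n → (α : Pt N) → InDil m v n α → Decomposes m v n α

VeryAmple : ∀ {N} (m : ℕ) → (Fin m → Pt N) → Set
VeryAmple {N} m v = Σ ℕ λ n₀ →
  (n : ℕ) → n₀ ℕ.≤ n → 1 ℕ.≤ n → (α : Pt N) → InDil m v n α → Decomposes m v n α

AffInd : ∀ {N} (m : ℕ) → (Fin m → Pt N) → Set
AffInd {N} m v = (λs : Fin m → ℚ) → Σℚ m λs ≡ 0ℚ →
  CombEq m λs v (replicate N (+ 0)) → (i : Fin m) → λs i ≡ 0ℚ

Simplex : ∀ {N} (d : ℕ) → (Fin (suc d) → Pt N) → Set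
Simplex d v = AffInd (suc d) v

EmptyPoly : ∀ {N} (m : ℕ) → (Fin m → Pt N) → Set
EmptyPoly {N} m v = (x : Pt N) → InPoly m v x → Σ (Fin m) λ i → x ≡ v i

-- The invariants, as predicates "μ_•(P) = j" for P = conv(v), v : Fin m → ℤ^N

MuVa : ∀ {N} (m : ℕ) → (Fin m → Pt N) → ℕ → Set
MuVa m v j = 1 ℕ.≤ j × VeryAmple m (dilate j v) ×
  ((k : ℕ) → 1 ℕ.≤ k → k ℕ.< j → ¬ VeryAmple m (dilate k v))

MuMidp : ∀ {N} (m : ℕ) → (Fin m → Pt N) → ℕ → Set
MuMidp m v j = 1 ℕ.≤ j × IDP m (dilate j v) ×
  ((k : ℕ) → 1 ℕ.≤ k → k ℕ.< j → ¬ IDP m (dilate k v))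

IDPFrom : ∀ {N} (m : ℕ) → (Fin m → Pt N) → ℕ → Set
IDPFrom m v k = (n : ℕ) → k ℕ.≤ n → IDP m (dilate n v)

MuIdp : ∀ {N} (m : ℕ) → (Fin m → Pt N) → ℕ → Set
MuIdp m v j = 1 ℕ.≤ j × IDPFrom m v j ×
  ((k : ℕ) → 1 ℕ.≤ k → k ℕ.< j → ¬ IDPFrom m v k)

-- lattice points of ℤ^{N+1} written as (α , degree)
CPt : ℕ → Set
CPt N = Pt N × ℤ

deg : ∀ {N} → CPt N → ℤ
deg (_ , n) = n

-- (α , n) ∈ C(P) ∩ ℤ^{N+1} : (α , n) = Σ c_i (v_i , 1) with c_i ≥ 0 rational
InCone : ∀ {N} (m : ℕ) → (Fin m → Pt N) → CPt N → Set
InCone m v (α , n) = Σ (Fin m → ℚ) λ cs →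
  ((i : Fin m) → 0ℚ ℚ.≤ cs i) × (Σℚ m cs ≡ toℚ n) × CombEq m cs v α

ΣCPt : ∀ {N} (r : ℕ) → (Fin r → ℕ) → (Fin r → CPt N) → CPt N
ΣCPt r a h = ΣPt r (λ i → (+ a i) · Data.Product.proj₁ (h i)) ,
             Σℤ r (λ i → (+ a i) ℤ.* deg (h i))

GeneratesUsing : ∀ {N} (m : ℕ) → (Fin m → Pt N) → (H : List (CPt N)) →
                 (Fin (length H) → Set) → Set
GeneratesUsing {N} m v H allowed = (x : CPt N) → InCone m v x →
  Σ (Fin (length H) → ℕ) λ a →
    ((i : Fin (length H)) → ¬ allowed i → a i ≡ 0) ×
    (ΣCPt (length H) a (lookup H) ≡ x)

IsHilbertBasis : ∀ {N} (m : ℕ) → (Fin m → Pt N) → List (CPt N) → Set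
IsHilbertBasis m v H =
  ((i : Fin (length H)) → InCone m v (lookup H i)) ×
  GeneratesUsing m v H (λ _ → Data.Unit.⊤)

-- H is a minimal Hilbert basis (no proper subset generates; equivalently
-- dropping any single entry destroys generation)
IsMinHilbertBasis : ∀ {N} (m : ℕ) → (Fin m → Pt N) → List (CPt N) → Set
IsMinHilbertBasis m v H = IsHilbertBasis m v H ×
  ((i : Fin (length H)) → ¬ GeneratesUsing m v H (λ k → k ≢ i))

-- μ_Hilb(P) = j : the (unique) minimal Hilbert basis has maximal degree j
MuHilb : ∀ {N} (m : ℕ) → (Fin m → Pt N) → ℕ → Set
MuHilb m v j = Σ (List (CPt _)) λ H → IsMinHilbertBasis m v H ×
  (Σ (Fin (length H)) λ i → deg (lookup H i) ≡ + j) ×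
  ((i : Fin (length H)) → deg (lookup H i) ℤ.≤ + j)

InBox : ∀ {N} (m : ℕ) → (Fin m → Pt N) → CPt N → Set
InBox m w (α , n) = Σ (Fin m → ℚ) λ rs →
  ((i : Fin m) → 0ℚ ℚ.≤ rs i × rs i ℚ.< 1ℚ) ×
  (Σℚ m rs ≡ toℚ n) × CombEq m rs w α

-- x ∈ ℤ_{≥0}(P̃ ∩ ℤ^{N+1}) : a finite sum of points (β , 1) with β ∈ P ∩ ℤ^N
InSemigroup : ∀ {N} (m : ℕ) → (Fin m → Pt N) → CPt N → Set
InSemigroup {N} m v (α , n) = Σ ℕ λ r → Σ (Fin r → Pt N) λ βs →
  ((i : Fin r) → InPoly m v (βs i)) × (ΣPt r βs ≡ α) × (+ r ≡ n)

InBoxP : ∀ {N} (d m : ℕ) → (Fin m → Pt N) → CPt N → Set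
InBoxP {N} d m v x =
  (Σ (Fin (suc d) → Pt N) λ w →
     Simplex d w × EmptyPoly (suc d) w ×
     ((i : Fin (suc d)) → InPoly m v (w i)) × InBox (suc d) w x) ×
  ¬ InSemigroup m v x

MuHole : ∀ {N} (d m : ℕ) → (Fin m → Pt N) → ℕ → Set
MuHole {N} d m v j =
  (((x : CPt N) → ¬ InBoxP d m v x) × j ≡ 1) ⊎
  ((Σ (CPt N) λ x → InBoxP d m v x × deg x ≡ + j) ×
   ((x : CPt N) → InBoxP d m v x → deg x ℤ.≤ + j))

HasCard : ∀ {N} → (Pt N → Set) → ℕ → Set
HasCard {N} S c = Σ (List (Pt N)) λ xs →
  length xs ≡ c × Unique xs × ((x : Pt N) → S x ⇔ (x ∈ xs))

-- δ_i : coefficient of t^i in (1 - t)^{d+1} · Σ_n L(n) t^n,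
-- i.e. Σ_{k=0}^{i} (-1)^k C(d+1,k) L(i-k)
sgn : ℕ → ℤ
sgn zero    = + 1
sgn (suc k) = ℤ.- sgn k

δ : (d : ℕ) → (ℕ → ℕ) → ℕ → ℤ
δ d L i = Σℤ (suc i) (λ k → sgn (Data.Fin.toℕ k) ℤ.*
            (+ ((suc d C Data.Fin.toℕ k) ℕ.* L (i ℕ.∸ Data.Fin.toℕ k))))

MuEhr : ∀ {N} (d m : ℕ) → (Fin m → Pt N) → ℕ → Set
MuEhr d m v j = Σ (ℕ → ℕ) λ L →
  ((n : ℕ) → HasCard (InDil m v n) (L n)) ×
  1 ℕ.≤ j × j ℕ.≤ d × δ d L j ≢ + 0 ×
  ((i : ℕ) → j ℕ.< i → i ℕ.≤ d → δ d L i ≡ + 0)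

{-# OPTIONS --safe #-}
module Submission where

-- The simplex has vertices (j , w) and the unit vectors e₁, …, e_d in ℤ^{d+1}, where w ∈ {0,1}^d has j + 1 ones.
-- The lattice points of its cone are the x with 0 ≤ x₀ and wᵢ x₀ ≤ j xᵢ, the degree is x₁ + ⋯ + x_d − x₀, and each
-- of them is uniquely a non-negative integral combination of the vertices plus (s , w) (or 0, for s = 0) with
-- 0 ≤ s < j, which for s > 0 has degree j + 1 − s.  These degrees are 2, …, j, so the δ-polynomial is 1 + t² + ⋯ + tʲ,
-- and for n ≥ j points of degree n with integral coefficients can be split off one by one, which makes the n-th
-- dilate IDP.  All obstructions come from one inequality: a cone point with x₀ ≥ 1 has degree at least j + 1 − x₀.
-- For x₀ = 1 it shows that (1 , w) + y, with y a combination of e₁, …, e_d, is not a sum of points of degree k < j: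
-- exactly one summand would have x₀ = 1.  It also shows that each (s , w) is irreducible.

open import Defs
open import Algebra.Bundles using (CommutativeRing)
import Algebra.Properties.Semiring.Sum as Sum
open import Data.Bool using (if_then_else_)
open import Data.Empty using (⊥-elim)
open import Data.Fin using (Fin; zero; suc; toℕ; fromℕ<; _≟_)
open import Data.Fin.Properties using (any?; toℕ<n; toℕ-injective; toℕ-fromℕ<)
open import Data.Integer as ℤ using (ℤ; +_)
import Data.Integer.Properties as ℤ
import Data.Integer.Tactic.RingSolver as ℤR
open import Data.List as List using (List; length) renaming (lookup to _‼_)
open import Data.List.Membership.Propositional using (_∈_)
open import Data.List.Membership.Propositional.Properties
  using (∈-++⁺ˡ; ∈-++⁺ʳ; ∈-++⁻; ∈-map⁺; ∈-map⁻; ∈-tabulate⁺; ∈-tabulate⁻; ∈-lookup)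
open import Data.List.Properties using (length-++; length-map)
open import Data.List.Relation.Unary.All as All using ([])
open import Data.List.Relation.Unary.AllPairs using ([]; _∷_)
open import Data.List.Relation.Unary.Any using (here; index)
open import Data.List.Relation.Unary.Any.Properties using (lookup-index)
open import Data.List.Relation.Unary.Unique.Propositional using (Unique)
import Data.List.Relation.Unary.Unique.Propositional.Properties as Unique
open import Data.Nat as ℕ using (ℕ; zero; suc; _≤_; _∸_; z≤n; s≤s)
open import Data.Nat.Combinatorics using (_C_; k>n⇒nCk≡0; nCk+nC[k+1]≡[n+1]C[k+1])
import Data.Nat.DivMod as ℕ
import Data.Nat.Properties as ℕ
import Data.Nat.Tactic.RingSolver as ℕR
open import Data.Product using (Σ; ∃; _×_; _,_; proj₁; proj₂)
open import Data.Rational as ℚ using (ℚ; 0ℚ; 1ℚ)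
import Data.Rational.Properties as ℚ
open import Data.Rational.Unnormalised as ℚᵘ using (mkℚᵘ; *≡*; *≤*; *<*; _≃_)
import Data.Rational.Unnormalised.Properties as ℚᵘ
open import Data.Sum using (_⊎_; inj₁; inj₂)
open import Data.Unit using (⊤; tt)
open import Data.Vec using (Vec; []; _∷_; zipWith; replicate; map; sum; tail) renaming (lookup to _!_)
open import Data.Vec.Properties
  using (lookup-map; lookup-zipWith; lookup-replicate; zipWith-comm; zipWith-identityˡ; zipWith-identityʳ)
open import Function using (_∘_; case_of_)
open import Function.Bundles using (mk⇔)
open import Relation.Binary.PropositionalEquality
open import Relation.Nullary using (¬_; yes; no)
open import Relation.Nullary.Decidable using (does; dec-true; dec-false)

-- The vertices lie on the hyperplane `x₁ + ⋯ + x_d − x₀ = 1`. This is why `w` has `j + 1` ones, and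
-- why the ambient space has one dimension more than the simplex: the degree becomes a linear form,
-- and a cone point is determined by `x` alone. The lattice spanned by the vertices has index `j`,
-- and its cosets are read off from `x₀` modulo `j`; these are the classes `s`. Since the entries of
-- `w` are 0 and 1, the condition `wᵢ s ≤ j xᵢ` with `0 < s < j` rounds up to `wᵢ ≤ xᵢ`, so every
-- cone point of class `s` is `(s , w)` plus an integral combination of vertices.
--
-- The same rounding is behind the key inequality: `x₀ ≥ 1` forces `xᵢ ≥ 1` at the `j + 1` ones of
-- `w`. A smaller `s > 0` means a larger degree, so `(1 , w)` accounts for the value `j` of all six
-- invariants. Its translates occur in every degree from `j` on; therefore one family of points
-- refutes very ampleness, and with it IDP, for all dilates below the `j`-th.

module ℚΣ = Sum (CommutativeRing.semiring ℚ.+-*-commutativeRing)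
module ℤΣ = Sum (CommutativeRing.semiring ℤ.+-*-commutativeRing)

-- Finite sums of rationals and integers

Σℚ≡sum : ∀ m (f : Fin m → ℚ) → Σℚ m f ≡ ℚΣ.sum f
Σℚ≡sum zero    f = refl
Σℚ≡sum (suc m) f = cong (f zero ℚ.+_) (Σℚ≡sum m (f ∘ suc))

Σℤ≡sum : ∀ m (f : Fin m → ℤ) → Σℤ m f ≡ ℤΣ.sum f
Σℤ≡sum zero    f = refl
Σℤ≡sum (suc m) f = cong (ℤ._+_ (f zero)) (Σℤ≡sum m (f ∘ suc))

Σℚ-cong : ∀ m {f g : Fin m → ℚ} → (∀ i → f i ≡ g i) → Σℚ m f ≡ Σℚ m g
Σℚ-cong zero    e = refl
Σℚ-cong (suc m) e = cong₂ ℚ._+_ (e zero) (Σℚ-cong m (e ∘ suc))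

Σℤ-cong : ∀ m {f g : Fin m → ℤ} → (∀ i → f i ≡ g i) → Σℤ m f ≡ Σℤ m g
Σℤ-cong zero    e = refl
Σℤ-cong (suc m) e = cong₂ ℤ._+_ (e zero) (Σℤ-cong m (e ∘ suc))

Σℤ-+ : ∀ m (f g : Fin m → ℤ) → Σℤ m (λ i → f i ℤ.+ g i) ≡ Σℤ m f ℤ.+ Σℤ m g
Σℤ-+ m f g = trans (Σℤ≡sum m _) (trans (ℤΣ.∑-distrib-+ f g)
  (sym (cong₂ ℤ._+_ (Σℤ≡sum m f) (Σℤ≡sum m g))))

Σℤ-*ˡ : ∀ m c (f : Fin m → ℤ) → Σℤ m (λ i → c ℤ.* f i) ≡ c ℤ.* Σℤ m f
Σℤ-*ˡ m c f = trans (Σℤ≡sum m _) (trans (sym (ℤΣ.*-distribˡ-sum c f))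
  (cong (c ℤ.*_) (sym (Σℤ≡sum m f))))

Σℚ-*ʳ : ∀ m (f : Fin m → ℚ) c → Σℚ m (λ i → f i ℚ.* c) ≡ Σℚ m f ℚ.* c
Σℚ-*ʳ m f c = trans (Σℚ≡sum m _) (trans (sym (ℚΣ.*-distribʳ-sum c f))
  (cong (ℚ._* c) (sym (Σℚ≡sum m f))))

Σℚ-swap : ∀ m n (f : Fin m → Fin n → ℚ) →
  Σℚ m (λ i → Σℚ n (f i)) ≡ Σℚ n (λ k → Σℚ m (λ i → f i k))
Σℚ-swap m n f = begin
  Σℚ m (λ i → Σℚ n (f i))             ≡⟨ Σℚ-cong m (λ i → Σℚ≡sum n (f i)) ⟩
  Σℚ m (λ i → ℚΣ.sum (f i))           ≡⟨ Σℚ≡sum m _ ⟩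
  ℚΣ.sum (λ i → ℚΣ.sum (f i))         ≡⟨ ℚΣ.∑-comm f ⟩
  ℚΣ.sum (λ k → ℚΣ.sum (λ i → f i k)) ≡⟨ Σℚ≡sum n _ ⟨
  Σℚ n (λ k → ℚΣ.sum (λ i → f i k))   ≡⟨ Σℚ-cong n (λ k → Σℚ≡sum m (λ i → f i k)) ⟨
  Σℚ n (λ k → Σℚ m (λ i → f i k))     ∎
  where open ≡-Reasoning

Σℚ-zero : ∀ m {f : Fin m → ℚ} → (∀ i → f i ≡ 0ℚ) → Σℚ m f ≡ 0ℚ
Σℚ-zero zero    e = refl
Σℚ-zero (suc m) e = trans (cong₂ ℚ._+_ (e zero) (Σℚ-zero m (e ∘ suc))) (ℚ.+-identityˡ 0ℚ)

Σℤ-zero : ∀ m {f : Fin m → ℤ} → (∀ i → f i ≡ + 0) → Σℤ m f ≡ + 0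
Σℤ-zero zero    e = refl
Σℤ-zero (suc m) e = cong₂ ℤ._+_ (e zero) (Σℤ-zero m (e ∘ suc))

Σℚ-single : ∀ {m} {f : Fin m → ℚ} k → (∀ i → i ≢ k → f i ≡ 0ℚ) → Σℚ m f ≡ f k
Σℚ-single {f = f} zero e =
  trans (cong (f zero ℚ.+_) (Σℚ-zero _ (λ i → e (suc i) λ ()))) (ℚ.+-identityʳ _)
Σℚ-single {f = f} (suc k) e =
  trans (cong₂ ℚ._+_ (e zero λ ()) (Σℚ-single k (λ i i≢k → e (suc i) λ { refl → i≢k refl })))
        (ℚ.+-identityˡ _)

-- The integers inside the rationals

toℚᵘ-toℚ : ∀ z → ℚ.toℚᵘ (toℚ z) ≃ mkℚᵘ z 0
toℚᵘ-toℚ z = ℚ.toℚᵘ-fromℚᵘ (mkℚᵘ z 0)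

-- Normalisation in `z ℚ./ 1` does not compute for a variable `z`, so facts about `toℚ` are proved
-- for unnormalised fractions and carried back along `toℚᵘ-toℚ`.
toℚ-+ : ∀ a b → toℚ (a ℤ.+ b) ≡ toℚ a ℚ.+ toℚ b
toℚ-+ a b = ℚ.toℚᵘ-injective (begin
  ℚ.toℚᵘ (toℚ (a ℤ.+ b))                ≈⟨ toℚᵘ-toℚ (a ℤ.+ b) ⟩
  mkℚᵘ (a ℤ.+ b) 0                      ≡⟨ cong₂ (λ x y → mkℚᵘ (x ℤ.+ y) 0) (ℤ.*-identityʳ a) (ℤ.*-identityʳ b) ⟨
  mkℚᵘ a 0 ℚᵘ.+ mkℚᵘ b 0                ≈⟨ ℚᵘ.+-cong (toℚᵘ-toℚ a) (toℚᵘ-toℚ b) ⟨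
  ℚ.toℚᵘ (toℚ a) ℚᵘ.+ ℚ.toℚᵘ (toℚ b)    ≈⟨ ℚ.toℚᵘ-homo-+ (toℚ a) (toℚ b) ⟨
  ℚ.toℚᵘ (toℚ a ℚ.+ toℚ b)              ∎)
  where open import Relation.Binary.Reasoning.Setoid ℚᵘ.≃-setoid

toℚ-* : ∀ a b → toℚ (a ℤ.* b) ≡ toℚ a ℚ.* toℚ b
toℚ-* a b = ℚ.toℚᵘ-injective (begin
  ℚ.toℚᵘ (toℚ (a ℤ.* b))                ≈⟨ toℚᵘ-toℚ (a ℤ.* b) ⟩
  mkℚᵘ a 0 ℚᵘ.* mkℚᵘ b 0                ≈⟨ ℚᵘ.*-cong (toℚᵘ-toℚ a) (toℚᵘ-toℚ b) ⟨
  ℚ.toℚᵘ (toℚ a) ℚᵘ.* ℚ.toℚᵘ (toℚ b)    ≈⟨ ℚ.toℚᵘ-homo-* (toℚ a) (toℚ b) ⟨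
  ℚ.toℚᵘ (toℚ a ℚ.* toℚ b)              ∎)
  where open import Relation.Binary.Reasoning.Setoid ℚᵘ.≃-setoid

toℚ-neg : ∀ a → toℚ (ℤ.- a) ≡ ℚ.- toℚ a
toℚ-neg a = ℚ.toℚᵘ-injective (begin
  ℚ.toℚᵘ (toℚ (ℤ.- a))     ≈⟨ toℚᵘ-toℚ (ℤ.- a) ⟩
  ℚᵘ.- mkℚᵘ a 0            ≈⟨ ℚᵘ.-‿cong (toℚᵘ-toℚ a) ⟨
  ℚᵘ.- ℚ.toℚᵘ (toℚ a)      ≈⟨ ℚ.toℚᵘ-homo‿- (toℚ a) ⟨
  ℚ.toℚᵘ (ℚ.- toℚ a)       ∎)
  where open import Relation.Binary.Reasoning.Setoid ℚᵘ.≃-setoid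

toℚ-injective : ∀ {a b} → toℚ a ≡ toℚ b → a ≡ b
toℚ-injective {a} {b} e
  with *≡* q ← ℚᵘ.≃-trans (ℚᵘ.≃-sym (toℚᵘ-toℚ a)) (ℚᵘ.≃-trans (ℚ.toℚᵘ-cong e) (toℚᵘ-toℚ b))
  = trans (sym (ℤ.*-identityʳ a)) (trans q (ℤ.*-identityʳ b))

toℚ-mono-≤ : ∀ {a b} → a ℤ.≤ b → toℚ a ℚ.≤ toℚ b
toℚ-mono-≤ {a} {b} a≤b = ℚ.toℚᵘ-cancel-≤
  (ℚᵘ.≤-respˡ-≃ (ℚᵘ.≃-sym (toℚᵘ-toℚ a)) (ℚᵘ.≤-respʳ-≃ (ℚᵘ.≃-sym (toℚᵘ-toℚ b))
    (*≤* (subst₂ ℤ._≤_ (sym (ℤ.*-identityʳ a)) (sym (ℤ.*-identityʳ b)) a≤b))))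

toℚ-mono-< : ∀ {a b} → a ℤ.< b → toℚ a ℚ.< toℚ b
toℚ-mono-< {a} {b} a<b = ℚ.toℚᵘ-cancel-<
  (ℚᵘ.<-respˡ-≃ (ℚᵘ.≃-sym (toℚᵘ-toℚ a)) (ℚᵘ.<-respʳ-≃ (ℚᵘ.≃-sym (toℚᵘ-toℚ b))
    (*<* (subst₂ ℤ._<_ (sym (ℤ.*-identityʳ a)) (sym (ℤ.*-identityʳ b)) a<b))))

toℚ-cancel-≤ : ∀ {a b} → toℚ a ℚ.≤ toℚ b → a ℤ.≤ b
toℚ-cancel-≤ {a} {b} h = ℤ.≮⇒≥ λ b<a → ℚ.<-irrefl refl (ℚ.<-≤-trans (toℚ-mono-< b<a) h)

toℚ-cancel-< : ∀ {a b} → toℚ a ℚ.< toℚ b → a ℤ.< b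
toℚ-cancel-< {a} {b} h = ℤ.≰⇒> λ b≤a → ℚ.<-irrefl refl (ℚ.<-≤-trans h (toℚ-mono-≤ b≤a))

toℚ-Σ : ∀ m (f : Fin m → ℤ) → toℚ (Σℤ m f) ≡ Σℚ m (λ i → toℚ (f i))
toℚ-Σ zero    f = refl
toℚ-Σ (suc m) f = trans (toℚ-+ (f zero) _) (cong (toℚ (f zero) ℚ.+_) (toℚ-Σ m (f ∘ suc)))

-- Clearing a common denominator `D`: bounds on a rational `q` become bounds on the integer `q D`.
-- It serves for barycentric coordinates, with `D` equal to `j`, and for division by a dilation
-- factor.
module Clear (D-1 : ℕ) where
  D : ℤ
  D = + suc D-1

  D⁻¹ : ℚ
  D⁻¹ = + 1 ℚ./ suc D-1

  D⁻¹*D : D⁻¹ ℚ.* toℚ D ≡ 1ℚ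
  D⁻¹*D = ℚ.toℚᵘ-injective (begin
    ℚ.toℚᵘ (D⁻¹ ℚ.* toℚ D)             ≈⟨ ℚ.toℚᵘ-homo-* D⁻¹ (toℚ D) ⟩
    ℚ.toℚᵘ D⁻¹ ℚᵘ.* ℚ.toℚᵘ (toℚ D)     ≈⟨ ℚᵘ.*-cong (ℚ.toℚᵘ-fromℚᵘ (mkℚᵘ (+ 1) D-1)) (toℚᵘ-toℚ D) ⟩
    mkℚᵘ (+ 1) D-1 ℚᵘ.* mkℚᵘ D 0       ≈⟨ *≡* (cong (λ n → + suc n) (trans (ℕ.*-identityʳ (D-1 ℕ.+ 0)) (cong (ℕ._+ 0) (sym (ℕ.*-identityʳ D-1))))) ⟩
    ℚ.toℚᵘ 1ℚ                          ∎)
    where open import Relation.Binary.Reasoning.Setoid ℚᵘ.≃-setoid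

  *D-cancel : ∀ q → (q ℚ.* D⁻¹) ℚ.* toℚ D ≡ q
  *D-cancel q = trans (ℚ.*-assoc q D⁻¹ (toℚ D)) (trans (cong (q ℚ.*_) D⁻¹*D) (ℚ.*-identityʳ q))

  *D-injective : ∀ {p q} → p ℚ.* toℚ D ≡ q ℚ.* toℚ D → p ≡ q
  *D-injective {p} {q} e = trans (sym (lem p)) (trans (cong (ℚ._* D⁻¹) e) (lem q))
    where
    lem : ∀ r → (r ℚ.* toℚ D) ℚ.* D⁻¹ ≡ r
    lem r = trans (ℚ.*-assoc r (toℚ D) D⁻¹)
      (trans (cong (r ℚ.*_) (trans (ℚ.*-comm (toℚ D) D⁻¹) D⁻¹*D)) (ℚ.*-identityʳ r))

  instance
    D-positive : ℚ.Positive (toℚ D)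
    D-positive = ℚ.positive (toℚ-mono-< {+ 0} {D} (ℤ.+<+ (ℕ.s≤s ℕ.z≤n)))

    D-nonNegative : ℚ.NonNegative (toℚ D)
    D-nonNegative = ℚ.pos⇒nonNeg (toℚ D)

  module _ {q z} (e : q ℚ.* toℚ D ≡ toℚ z) where
    0≤-numerator : 0ℚ ℚ.≤ q → + 0 ℤ.≤ z
    0≤-numerator h = toℚ-cancel-≤ {+ 0} {z}
      (subst₂ ℚ._≤_ (ℚ.*-zeroˡ (toℚ D)) e (ℚ.*-monoʳ-≤-nonNeg (toℚ D) h))

    0≤-quotient : + 0 ℤ.≤ z → 0ℚ ℚ.≤ q
    0≤-quotient h = ℚ.*-cancelʳ-≤-pos (toℚ D)
      (subst₂ ℚ._≤_ (sym (ℚ.*-zeroˡ (toℚ D))) (sym e) (toℚ-mono-≤ {+ 0} {z} h))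

    numerator-<D : q ℚ.< 1ℚ → z ℤ.< D
    numerator-<D h = toℚ-cancel-< {z} {D}
      (subst₂ ℚ._<_ e (ℚ.*-identityˡ (toℚ D)) (ℚ.*-monoˡ-<-pos (toℚ D) h))

    quotient-<1 : z ℤ.< D → q ℚ.< 1ℚ
    quotient-<1 h = ℚ.*-cancelʳ-<-nonNeg (toℚ D)
      (subst₂ ℚ._<_ (sym e) (sym (ℚ.*-identityˡ (toℚ D))) (toℚ-mono-< {z} {D} h))

-- Vectors of natural numbers and their coordinate sums

unit : ∀ {n} → Fin n → Vec ℕ n
unit zero    = 1 ∷ replicate _ 0
unit (suc i) = 0 ∷ unit i

sum-replicate-0 : ∀ n → sum (replicate n 0) ≡ 0
sum-replicate-0 zero    = refl
sum-replicate-0 (suc n) = sum-replicate-0 n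

sum-zero : ∀ {n} (a : Vec ℕ n) → (∀ i → a ! i ≡ 0) → sum a ≡ 0
sum-zero []      h = refl
sum-zero (x ∷ a) h = cong₂ ℕ._+_ (h zero) (sum-zero a (h ∘ suc))

sum-unit : ∀ {n} (i : Fin n) → sum (unit i) ≡ 1
sum-unit {suc n} zero    = cong suc (sum-replicate-0 n)
sum-unit (suc i) = sum-unit i

sum≡0⇒replicate : ∀ {n} (a : Vec ℕ n) → sum a ≡ 0 → a ≡ replicate n 0
sum≡0⇒replicate []         e = refl
sum≡0⇒replicate (zero ∷ a) e = cong (0 ∷_) (sum≡0⇒replicate a e)

sum≡1⇒unit : ∀ {n} (a : Vec ℕ n) → sum a ≡ 1 → ∃ λ i → a ≡ unit i
sum≡1⇒unit (zero  ∷ a) e with i , e′ ← sum≡1⇒unit a e = suc i , cong (0 ∷_) e′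
sum≡1⇒unit (suc zero ∷ a) e = zero , cong (1 ∷_) (sum≡0⇒replicate a (ℕ.suc-injective e))

infixl 6 _⊕_
_⊕_ : ∀ {n} → Vec ℕ n → Vec ℕ n → Vec ℕ n
_⊕_ = zipWith ℕ._+_

sum-⊕ : ∀ {n} (a b : Vec ℕ n) → sum (a ⊕ b) ≡ sum a ℕ.+ sum b
sum-⊕ []      []      = refl
sum-⊕ (x ∷ a) (y ∷ b) = trans (cong (x ℕ.+ y ℕ.+_) (sum-⊕ a b)) (lem x y (sum a) (sum b))
  where lem : ∀ x y s t → x ℕ.+ y ℕ.+ (s ℕ.+ t) ≡ x ℕ.+ s ℕ.+ (y ℕ.+ t)
        lem = ℕR.solve-∀

-- Greedy from the left: the first coordinate yields as much of `m` as it can. Integral combinations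
-- of vertices are cut into pieces of prescribed degree in this way.
split : ∀ {n} (a : Vec ℕ n) m → m ℕ.≤ sum a → ∃ λ b → ∃ λ c → b ⊕ c ≡ a × sum b ≡ m
split []      .0 z≤n = [] , [] , refl , refl
split {suc n} (x ∷ a) m  m≤ with ℕ.≤-total m x
... | inj₁ m≤x = m ∷ replicate _ 0 , x ℕ.∸ m ∷ a ,
  cong₂ _∷_ (ℕ.m+[n∸m]≡n m≤x) (zipWith-identityˡ ℕ.+-identityˡ a) , trans (cong (m ℕ.+_) (sum-replicate-0 n)) (ℕ.+-identityʳ m)
... | inj₂ x≤m with b , c , b⊕c , Σb ← split a (m ℕ.∸ x) (ℕ.m≤n+o⇒m∸n≤o m x m≤) =
  x ∷ b , 0 ∷ c , cong₂ _∷_ (ℕ.+-identityʳ x) b⊕c ,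
  trans (cong (x ℕ.+_) Σb) (ℕ.m+[n∸m]≡n x≤m)

-- Integer points and their coordinates

infixl 6 _⊞_
_⊞_ : ∀ {N} → Pt N → Pt N → Pt N
_⊞_ = zipWith ℤ._+_

total : ∀ {n} → Vec ℤ n → ℤ
total x = Σℤ _ (x !_)

total-⊞ : ∀ {n} (x y : Pt n) → total (x ⊞ y) ≡ total x ℤ.+ total y
total-⊞ x y = trans (Σℤ-cong _ (λ i → lookup-zipWith ℤ._+_ i x y)) (Σℤ-+ _ (x !_) (y !_))

Σℚ-unit : ∀ {n} (f : Fin n → ℚ) k → Σℚ n (λ i → f i ℚ.* toℚ (map +_ (unit i) ! k)) ≡ f k
Σℚ-unit f k = trans (Σℚ-single k λ i i≢k → trans (cong (λ z → f i ℚ.* toℚ z) (off i k i≢k)) (ℚ.*-zeroʳ (f i)))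
  (trans (cong (λ z → f k ℚ.* toℚ z) (on k)) (ℚ.*-identityʳ (f k)))
  where
  0s : ∀ n k → map +_ (replicate n 0) ! k ≡ + 0
  0s (suc n) zero    = refl
  0s (suc n) (suc k) = 0s n k
  off : ∀ {n} (i k : Fin n) → i ≢ k → map +_ (unit i) ! k ≡ + 0
  off zero    zero    h = ⊥-elim (h refl)
  off zero    (suc k) h = 0s _ k
  off (suc i) zero    h = refl
  off (suc i) (suc k) h = off i k (h ∘ cong suc)
  on : ∀ {n} (k : Fin n) → map +_ (unit k) ! k ≡ + 1
  on zero    = refl
  on (suc k) = on k

lookup-ΣPt : ∀ {N} m (f : Fin m → Pt N) c → ΣPt m f ! c ≡ Σℤ m (λ i → f i ! c)
lookup-ΣPt zero    f c = lookup-replicate c (+ 0)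
lookup-ΣPt (suc m) f c = trans (lookup-zipWith ℤ._+_ c (f zero) _)
  (cong (ℤ._+_ (f zero ! c)) (lookup-ΣPt m (f ∘ suc) c))

Σℤ-nonneg : ∀ m (f : Fin m → ℤ) → (∀ i → + 0 ℤ.≤ f i) → + 0 ℤ.≤ Σℤ m f
Σℤ-nonneg zero    f h = ℤ.≤-refl
Σℤ-nonneg (suc m) f h = ℤ.+-mono-≤ (h zero) (Σℤ-nonneg m (f ∘ suc) (h ∘ suc))

-- Meant for the zeroth coordinates of the summands of a point with `x₀ = 1`.
Σℤ≡1⇒unit-summand : ∀ m (f : Fin m → ℤ) → (∀ i → + 0 ℤ.≤ f i) → Σℤ m f ≡ + 1 → ∃ λ i → f i ≡ + 1
Σℤ≡1⇒unit-summand (suc m) f h e with f zero in eq | h zero | Σℤ m (f ∘ suc) in eq′ | Σℤ-nonneg m (f ∘ suc) (h ∘ suc)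
... | + 0     | _ | + y | _ with i , p ← Σℤ≡1⇒unit-summand m (f ∘ suc) (h ∘ suc) (trans eq′ e) = suc i , p
... | + suc n | _ | + y | _ =
  zero , trans eq (cong (λ m → + suc m) (ℕ.m+n≡0⇒m≡0 n (ℕ.suc-injective (ℤ.+-injective e))))

-- Dilates, and coefficients scaled by the dilation factor

dilate⇒ : ∀ {N} m (v : Fin m → Pt N) k n x → InDil m (dilate k v) n x → InDil m v (k ℕ.* n) x
dilate⇒ m v k n x (λs , λ≥0 , Σλ , e) =
  (λ i → λs i ℚ.* K) ,
  (λ i → subst (ℚ._≤ λs i ℚ.* K) (ℚ.*-zeroˡ K) (ℚ.*-monoʳ-≤-nonNeg K (λ≥0 i))) ,
  trans (Σℚ-*ʳ m λs K) (trans (cong (ℚ._* K) Σλ)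
    (trans (sym (toℚ-* (+ n) (+ k))) (cong toℚ (trans (sym (ℤ.pos-* n k)) (cong +_ (ℕ.*-comm n k)))))) ,
  (λ c → trans (Σℚ-cong m (λ i → trans (ℚ.*-assoc (λs i) K _) (cong (λs i ℚ.*_)
    (trans (sym (toℚ-* (+ k) (v i ! c))) (cong toℚ (sym (lookup-map c (ℤ._*_ (+ k)) (v i)))))))) (e c))
  where
  K = toℚ (+ k)
  instance
    K≥0 : ℚ.NonNegative K
    K≥0 = ℚ.nonNegative (toℚ-mono-≤ {+ 0} {+ k} (ℤ.+≤+ z≤n))

-- Together with the converse `dilate⇒`, this moves every question about the `k`-th dilate into the
-- degrees `k n` of a single cone.
dilate⇐ : ∀ {N} m (v : Fin m → Pt N) k n x → 1 ℕ.≤ k → InDil m v (k ℕ.* n) x → InDil m (dilate k v) n x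
dilate⇐ m v (suc k-1) n x _ (λs , λ≥0 , Σλ , e) =
  (λ i → λs i ℚ.* D⁻¹) ,
  (λ i → ℚ.*-cancelʳ-≤-pos (toℚ D) (subst₂ ℚ._≤_ (sym (ℚ.*-zeroˡ (toℚ D))) (sym (*D-cancel (λs i))) (λ≥0 i))) ,
  *D-injective (trans (cong (ℚ._* toℚ D) (Σℚ-*ʳ m λs D⁻¹)) (trans (*D-cancel (Σℚ m λs)) (trans Σλ
    (trans (cong toℚ (trans (cong +_ (ℕ.*-comm (suc k-1) n)) (ℤ.pos-* n (suc k-1)))) (toℚ-* (+ n) D))))) ,
  (λ c → trans (Σℚ-cong m (λ i → trans (cong (λs i ℚ.* D⁻¹ ℚ.*_)
    (trans (cong toℚ (lookup-map c (ℤ._*_ D) (v i))) (toℚ-* D (v i ! c))))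
    (trans (sym (ℚ.*-assoc (λs i ℚ.* D⁻¹) (toℚ D) _)) (cong (ℚ._* toℚ (v i ! c)) (*D-cancel (λs i)))))) (e c))
  where open Clear k-1

idp⇒veryAmple : ∀ {N m} {p : Fin m → Pt N} → IDP m p → VeryAmple m p
idp⇒veryAmple idp = 0 , λ n _ → idp n

-- A nonzero sum excludes length 0, and then the first coordinate can carry all of `M`.
vec-with-sum : ∀ {n} (ω : Vec ℕ n) → sum ω ≢ 0 → ∀ M → ∃ λ (a : Vec ℕ n) → sum a ≡ M
vec-with-sum []      ω≢0 M = ⊥-elim (ω≢0 refl)
vec-with-sum {suc n} (o ∷ ω) _   M = M ∷ replicate n 0 ,
  trans (cong (M ℕ.+_) (sum-replicate-0 n)) (ℕ.+-identityʳ M)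

-- Indicators and relabelling of vertices

indicator : ∀ {n} → Fin n → Fin n → ℚ
indicator i k = if does (i ≟ k) then 1ℚ else 0ℚ

indicator-≡ : ∀ {n} {i k : Fin n} → i ≡ k → indicator i k ≡ 1ℚ
indicator-≡ {i = i} {k} e = cong (if_then 1ℚ else 0ℚ) (dec-true (i ≟ k) e)

indicator-≢ : ∀ {n} {i k : Fin n} → i ≢ k → indicator i k ≡ 0ℚ
indicator-≢ {i = i} {k} e = cong (if_then 1ℚ else 0ℚ) (dec-false (i ≟ k) e)

Σℚ-indicator : ∀ {n} i (f : Fin n → ℚ) → Σℚ n (λ k → indicator i k ℚ.* f k) ≡ f i
Σℚ-indicator i f = trans
  (Σℚ-single i (λ k k≢i → trans (cong (ℚ._* f k) (indicator-≢ (k≢i ∘ sym))) (ℚ.*-zeroˡ (f k))))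
  (trans (cong (ℚ._* f i) (indicator-≡ {i = i} refl)) (ℚ.*-identityˡ (f i)))

Σℚ-+ : ∀ m (f g : Fin m → ℚ) → Σℚ m (λ i → f i ℚ.+ g i) ≡ Σℚ m f ℚ.+ Σℚ m g
Σℚ-+ m f g = trans (Σℚ≡sum m _) (trans (ℚΣ.∑-distrib-+ f g)
  (sym (cong₂ ℚ._+_ (Σℚ≡sum m f) (Σℚ≡sum m g))))

-- If the vertices of one simplex are the points `σ i` of another, this turns coefficients for the
-- first into coefficients for the second.
pushforward : ∀ {m n} → (Fin m → Fin n) → (Fin m → ℚ) → Fin n → ℚ
pushforward {m} σ r k = Σℚ m (λ i → r i ℚ.* indicator (σ i) k)

Σℚ-pushforward : ∀ {m n} (σ : Fin m → Fin n) r (f : Fin n → ℚ) →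
  Σℚ n (λ k → pushforward σ r k ℚ.* f k) ≡ Σℚ m (λ i → r i ℚ.* f (σ i))
Σℚ-pushforward {m} {n} σ r f = begin
  Σℚ n (λ k → pushforward σ r k ℚ.* f k)                        ≡⟨ Σℚ-cong n (λ k → Σℚ-*ʳ m _ (f k)) ⟨
  Σℚ n (λ k → Σℚ m (λ i → r i ℚ.* indicator (σ i) k ℚ.* f k))   ≡⟨ Σℚ-swap n m _ ⟩
  Σℚ m (λ i → Σℚ n (λ k → r i ℚ.* indicator (σ i) k ℚ.* f k))   ≡⟨ Σℚ-cong m (λ i → inner i) ⟩
  Σℚ m (λ i → r i ℚ.* f (σ i))                                  ∎
  where
  open ≡-Reasoning
  inner : ∀ i → Σℚ n (λ k → r i ℚ.* indicator (σ i) k ℚ.* f k) ≡ r i ℚ.* f (σ i)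
  inner i = begin
    Σℚ n (λ k → r i ℚ.* indicator (σ i) k ℚ.* f k)
      ≡⟨ Σℚ-cong n (λ k → trans (ℚ.*-assoc (r i) _ (f k)) (ℚ.*-comm (r i) _)) ⟩
    Σℚ n (λ k → indicator (σ i) k ℚ.* f k ℚ.* r i)   ≡⟨ Σℚ-*ʳ n _ (r i) ⟩
    Σℚ n (λ k → indicator (σ i) k ℚ.* f k) ℚ.* r i   ≡⟨ cong (ℚ._* r i) (Σℚ-indicator (σ i) f) ⟩
    f (σ i) ℚ.* r i                                  ≡⟨ ℚ.*-comm (f (σ i)) (r i) ⟩
    r i ℚ.* f (σ i)                                  ∎

-- Injectivity of `σ` leaves at most one nonzero term in each sum, so every value is 0 or some
-- `r i`. Without it, coefficients below 1 could add up to 1 or more.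
pushforward-range : ∀ {m n} (σ : Fin m → Fin n) r (P : ℚ → Set) → (∀ {i k} → σ i ≡ σ k → i ≡ k) →
  P 0ℚ → (∀ i → P (r i)) → ∀ k → P (pushforward σ r k)
pushforward-range σ r P inj P0 Pr k with any? (λ i → σ i ≟ k)
... | no  ∄i          = subst P (sym (Σℚ-zero _ λ i →
  trans (cong (r i ℚ.*_) (indicator-≢ λ e → ∄i (i , e))) (ℚ.*-zeroʳ (r i)))) P0
... | yes (i , refl) = subst P (sym (trans
  (Σℚ-single i λ l l≢i → trans (cong (r l ℚ.*_) (indicator-≢ (l≢i ∘ inj))) (ℚ.*-zeroʳ (r l)))
  (trans (cong (r i ℚ.*_) (indicator-≡ {i = σ i} refl)) (ℚ.*-identityʳ (r i))))) (Pr i)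

-- Coefficients 1 and -1 at two equal points would be a nontrivial affine relation.
affInd⇒injective : ∀ {N m} (p : Fin m → Pt N) → AffInd m p → ∀ {i k} → p i ≡ p k → i ≡ k
affInd⇒injective {N} {m} p ind {i} {k} e with i ≟ k
... | yes i≡k = i≡k
... | no  i≢k = ⊥-elim (case trans (sym λi) (ind λs Σλ comb i) of λ ())
  where
  λs : Fin m → ℚ
  λs l = indicator i l ℚ.- indicator k l
  λs-* : ∀ (f : Fin m → ℚ) → f i ≡ f k → Σℚ m (λ l → λs l ℚ.* f l) ≡ 0ℚ
  λs-* f fi≡fk = begin
    Σℚ m (λ l → λs l ℚ.* f l)
      ≡⟨ Σℚ-cong m (λ l → trans (ℚ.*-distribʳ-+ (f l) (indicator i l) _)
           (cong (indicator i l ℚ.* f l ℚ.+_) (sym (minus (indicator k l) (f l))))) ⟩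
    Σℚ m (λ l → indicator i l ℚ.* f l ℚ.+ indicator k l ℚ.* f l ℚ.* ℚ.- 1ℚ)
      ≡⟨ Σℚ-+ m _ _ ⟩
    Σℚ m (λ l → indicator i l ℚ.* f l) ℚ.+ Σℚ m (λ l → indicator k l ℚ.* f l ℚ.* ℚ.- 1ℚ)
      ≡⟨ cong₂ ℚ._+_ (Σℚ-indicator i f) (trans (Σℚ-*ʳ m _ (ℚ.- 1ℚ)) (cong (ℚ._* ℚ.- 1ℚ) (Σℚ-indicator k f))) ⟩
    f i ℚ.+ f k ℚ.* ℚ.- 1ℚ
      ≡⟨ cong (f i ℚ.+_) (trans (sym (ℚ.neg-distribʳ-* (f k) 1ℚ)) (cong ℚ.-_ (ℚ.*-identityʳ (f k)))) ⟩
    f i ℚ.- f k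
      ≡⟨ trans (cong (ℚ._- f k) fi≡fk) (ℚ.+-inverseʳ (f k)) ⟩
    0ℚ ∎
    where
    open ≡-Reasoning
    minus : ∀ a b → a ℚ.* b ℚ.* ℚ.- 1ℚ ≡ ℚ.- a ℚ.* b
    minus a b = trans (sym (ℚ.neg-distribʳ-* (a ℚ.* b) 1ℚ))
      (trans (cong ℚ.-_ (ℚ.*-identityʳ (a ℚ.* b))) (ℚ.neg-distribˡ-* a b))
  Σλ : Σℚ m λs ≡ 0ℚ
  Σλ = trans (sym (Σℚ-cong m (λ l → ℚ.*-identityʳ (λs l)))) (λs-* (λ _ → 1ℚ) refl)
  comb : CombEq m λs p (replicate N (+ 0))
  comb c = trans (λs-* (λ l → toℚ (p l ! c)) (cong (λ x → toℚ (x ! c)) e))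
    (cong toℚ (sym (lookup-replicate c (+ 0))))
  λi : λs i ≡ 1ℚ
  λi = cong₂ ℚ._-_ (indicator-≡ {i = i} refl) (indicator-≢ (i≢k ∘ sym))

-- Generators and irreducible elements

infixl 6 _+ᶜ_
_+ᶜ_ : ∀ {N} → CPt N → CPt N → CPt N
(x , m) +ᶜ (y , n) = x ⊞ y , m ℤ.+ n

0ᶜ : ∀ {N} → CPt N
0ᶜ = replicate _ (+ 0) , + 0

infixl 7 _*ᶜ_
_*ᶜ_ : ∀ {N} → ℕ → CPt N → CPt N
k *ᶜ (x , n) = (+ k) · x , + k ℤ.* n

+ᶜ-identityˡ : ∀ {N} (x : CPt N) → 0ᶜ +ᶜ x ≡ x
+ᶜ-identityˡ (x , n) = cong₂ _,_ (zipWith-identityˡ ℤ.+-identityˡ x) (ℤ.+-identityˡ n)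

+ᶜ-identityʳ : ∀ {N} (x : CPt N) → x +ᶜ 0ᶜ ≡ x
+ᶜ-identityʳ (x , n) = cong₂ _,_ (zipWith-identityʳ ℤ.+-identityʳ x) (ℤ.+-identityʳ n)

0*ᶜ : ∀ {N} (x : CPt N) → 0 *ᶜ x ≡ 0ᶜ
0*ᶜ (x , n) = cong₂ _,_ (go x) (ℤ.*-zeroˡ n)
  where
  go : ∀ {N} (x : Pt N) → (+ 0) · x ≡ replicate N (+ 0)
  go []      = refl
  go (y ∷ x) = cong₂ _∷_ (ℤ.*-zeroˡ y) (go x)

suc-*ᶜ : ∀ {N} k (x : CPt N) → suc k *ᶜ x ≡ x +ᶜ k *ᶜ x
suc-*ᶜ k (x , n) = cong₂ _,_ (go x) (lem (+ k) n)
  where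
  lem : ∀ k y → (+ 1 ℤ.+ k) ℤ.* y ≡ y ℤ.+ k ℤ.* y
  lem = ℤR.solve-∀
  go : ∀ {N} (x : Pt N) → (+ suc k) · x ≡ x ⊞ ((+ k) · x)
  go []      = refl
  go (y ∷ x) = cong₂ _∷_ (lem (+ k) y) (go x)

*ᶜ-interchange : ∀ {N} a b (h x y : CPt N) →
  (a ℕ.+ b) *ᶜ h +ᶜ (x +ᶜ y) ≡ (a *ᶜ h +ᶜ x) +ᶜ (b *ᶜ h +ᶜ y)
*ᶜ-interchange a b (h , k) (x , m) (y , n) = cong₂ _,_ (go h x y) (lem (+ a) (+ b) k m n)
  where
  lem : ∀ a b h x y → (a ℤ.+ b) ℤ.* h ℤ.+ (x ℤ.+ y) ≡ (a ℤ.* h ℤ.+ x) ℤ.+ (b ℤ.* h ℤ.+ y)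
  lem = ℤR.solve-∀
  go : ∀ {N} (h x y : Pt N) → ((+ (a ℕ.+ b)) · h) ⊞ (x ⊞ y) ≡ (((+ a) · h) ⊞ x) ⊞ (((+ b) · h) ⊞ y)
  go []      []      []      = refl
  go (h ∷ r) (x ∷ p) (y ∷ q) = cong₂ _∷_ (lem (+ a) (+ b) h x y) (go r p q)

ΣCPt-zero : ∀ {N} r {a} (h : Fin r → CPt N) → (∀ i → a i ≡ 0) → ΣCPt r a h ≡ 0ᶜ
ΣCPt-zero zero    h a≡0 = refl
ΣCPt-zero (suc r) h a≡0 = trans
  (cong₂ _+ᶜ_ (trans (cong (_*ᶜ h zero) (a≡0 zero)) (0*ᶜ (h zero))) (ΣCPt-zero r (h ∘ suc) (a≡0 ∘ suc)))
  (+ᶜ-identityˡ 0ᶜ)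

ΣCPt-+ : ∀ {N} r a b (h : Fin r → CPt N) → ΣCPt r (λ i → a i ℕ.+ b i) h ≡ ΣCPt r a h +ᶜ ΣCPt r b h
ΣCPt-+ zero    a b h = sym (+ᶜ-identityˡ 0ᶜ)
ΣCPt-+ (suc r) a b h = trans (cong ((a zero ℕ.+ b zero) *ᶜ h zero +ᶜ_) (ΣCPt-+ r (a ∘ suc) (b ∘ suc) (h ∘ suc)))
  (*ᶜ-interchange (a zero) (b zero) (h zero) _ _)

1*ᶜ : ∀ {N} (x : CPt N) → 1 *ᶜ x ≡ x
1*ᶜ x = trans (suc-*ᶜ 0 x) (trans (cong (x +ᶜ_) (0*ᶜ x)) (+ᶜ-identityʳ x))

ΣCPt-unit : ∀ {N} r (h : Fin r → CPt N) k → ΣCPt r (unit k !_) h ≡ h k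
ΣCPt-unit (suc r) h zero    = trans
  (cong₂ _+ᶜ_ (1*ᶜ (h zero)) (ΣCPt-zero r (h ∘ suc) (λ i → lookup-replicate i 0)))
  (+ᶜ-identityʳ (h zero))
ΣCPt-unit (suc r) h (suc k) = trans (cong₂ _+ᶜ_ (0*ᶜ (h zero)) (ΣCPt-unit r (h ∘ suc) k)) (+ᶜ-identityˡ _)

Generated : ∀ {N} → List (CPt N) → CPt N → Set
Generated H x = ∃ λ (a : Fin (length H) → ℕ) → ΣCPt (length H) a (H ‼_) ≡ x

generated-0 : ∀ {N} (H : List (CPt N)) → Generated H 0ᶜ
generated-0 H = (λ _ → 0) , ΣCPt-zero (length H) (H ‼_) (λ _ → refl)

generated-+ : ∀ {N} {H : List (CPt N)} {x y} → Generated H x → Generated H y → Generated H (x +ᶜ y)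
generated-+ {H = H} (a , p) (b , q) = (λ i → a i ℕ.+ b i) , trans (ΣCPt-+ (length H) a b (H ‼_)) (cong₂ _+ᶜ_ p q)

generated-∈ : ∀ {N} {H : List (CPt N)} {x} → x ∈ H → Generated H x
generated-∈ {H = H} x∈H = (unit (index x∈H) !_) ,
  trans (ΣCPt-unit (length H) (H ‼_) (index x∈H)) (sym (lookup-index x∈H))

generated⇒GeneratesUsing : ∀ {N m} (p : Fin m → Pt N) H → (∀ x → InCone m p x → Generated H x) →
  GeneratesUsing m p H (λ _ → ⊤)
generated⇒GeneratesUsing p H gen x x∈ = proj₁ (gen x x∈) , (λ _ ¬tt → ⊥-elim (¬tt tt)) , proj₂ (gen x x∈)

unique-lookup : ∀ {A : Set} {xs : List A} → Unique xs → ∀ {i k} → xs ‼ i ≡ xs ‼ k → i ≡ k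
unique-lookup (x∉ ∷ _) {zero}  {zero}  e = refl
unique-lookup (x∉ ∷ _) {zero}  {suc k} e = ⊥-elim (All.lookup x∉ (∈-lookup k) e)
unique-lookup (x∉ ∷ _) {suc i} {zero}  e = ⊥-elim (All.lookup x∉ (∈-lookup i) (sym e))
unique-lookup (_ ∷ u)  {suc i} {suc k} e = cong suc (unique-lookup u e)

-- Minimality of a generating set is an argument about any submonoid; here `M` will be the semigroup
-- of lattice points of the cone.
module Irreducibility {N} (M : CPt N → Set) (M-0 : M 0ᶜ) (M-+ : ∀ {x y} → M x → M y → M (x +ᶜ y)) where

  -- Zero is not excluded by this definition, hence the separate hypotheses `x ≢ 0ᶜ` below.
  Irreducible : CPt N → Set
  Irreducible x = ∀ {y z} → M y → M z → y +ᶜ z ≡ x → y ≡ 0ᶜ ⊎ z ≡ 0ᶜ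

  M-* : ∀ k {x} → M x → M (k *ᶜ x)
  M-* zero    {x} c = subst M (sym (0*ᶜ x)) M-0
  M-* (suc k) {x} c = subst M (sym (suc-*ᶜ k x)) (M-+ c (M-* k c))

  M-Σ : ∀ r a h → (∀ i → M (h i)) → M (ΣCPt r a h)
  M-Σ zero    a h c = M-0
  M-Σ (suc r) a h c = M-+ (M-* (a zero) (c zero)) (M-Σ r (a ∘ suc) (h ∘ suc) (c ∘ suc))

  irreducible-multiple : ∀ k {h x} → M h → h ≢ 0ᶜ → Irreducible x → x ≢ 0ᶜ → k *ᶜ h ≡ x → k ≢ 0 × h ≡ x
  irreducible-multiple zero    {h} c h≢0 irr x≢0 e = ⊥-elim (x≢0 (trans (sym e) (0*ᶜ h)))
  irreducible-multiple (suc k) {h} c h≢0 irr x≢0 e = (λ ()) , go (irr c (M-* k c) (trans (sym (suc-*ᶜ k h)) e))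
    where
    go : h ≡ 0ᶜ ⊎ k *ᶜ h ≡ 0ᶜ → h ≡ _
    go (inj₁ h≡0) = ⊥-elim (h≢0 h≡0)
    go (inj₂ e₀)  = trans (sym (+ᶜ-identityʳ h)) (trans (cong (h +ᶜ_) (sym e₀)) (trans (sym (suc-*ᶜ k h)) e))

  -- Irreducibility makes either the first multiple or the remaining sum vanish. In the latter case
  -- `irreducible-multiple` applies to the first, otherwise the induction goes on with the rest.
  irreducible-summand : ∀ r a h {x} → (∀ i → M (h i)) → (∀ i → h i ≢ 0ᶜ) → Irreducible x → x ≢ 0ᶜ →
    ΣCPt r a h ≡ x → ∃ λ k → a k ≢ 0 × h k ≡ x
  irreducible-summand zero    a h c h≢0 irr x≢0 e = ⊥-elim (x≢0 (sym e))
  irreducible-summand (suc r) a h {x} c h≢0 irr x≢0 e =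
    go (irr (M-* (a zero) (c zero)) (M-Σ r (a ∘ suc) (h ∘ suc) (c ∘ suc)) e)
    where
    rest = ΣCPt r (a ∘ suc) (h ∘ suc)
    go : a zero *ᶜ h zero ≡ 0ᶜ ⊎ rest ≡ 0ᶜ → ∃ λ k → a k ≢ 0 × h k ≡ x
    go (inj₁ e₀) with k , p ← irreducible-summand r (a ∘ suc) (h ∘ suc) (c ∘ suc) (h≢0 ∘ suc) irr x≢0
      (trans (sym (+ᶜ-identityˡ rest)) (trans (cong (_+ᶜ rest) (sym e₀)) e)) = suc k , p
    go (inj₂ e₀) = zero , irreducible-multiple (a zero) (c zero) (h≢0 zero) irr x≢0
      (trans (sym (+ᶜ-identityʳ _)) (trans (cong (a zero *ᶜ h zero +ᶜ_) (sym e₀)) e))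

  -- A sum equal to an irreducible entry contains that entry with nonzero coefficient, and by
  -- uniqueness it sits at index `i` only. The hypothesis on `a` has the double negation with which
  -- `GeneratesUsing` forbids an index.
  irreducibles-independent : ∀ H → Unique H → (∀ {x} → x ∈ H → M x) → (∀ {x} → x ∈ H → x ≢ 0ᶜ) →
    (∀ {x} → x ∈ H → Irreducible x) → ∀ i a → (∀ k → ¬ k ≢ i → a k ≡ 0) → ΣCPt (length H) a (H ‼_) ≢ H ‼ i
  irreducibles-independent H unique inC ≢0 irr i a a≡0 e
    with k , aₖ≢0 , hₖ≡hᵢ ← irreducible-summand (length H) a (H ‼_) (λ k → inC (∈-lookup k))
           (λ k → ≢0 (∈-lookup k)) (irr (∈-lookup i)) (≢0 (∈-lookup i)) e
    = aₖ≢0 (a≡0 k (λ k≢i → k≢i (unique-lookup unique hₖ≡hᵢ)))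

-- Iterated differences and the δ-vector

-- Multiplication of the generating series by `1 - t`; the value at 0 stays, as if preceded by a
-- coefficient 0.
Δ : (ℕ → ℤ) → ℕ → ℤ
Δ f zero    = f zero
Δ f (suc n) = f (suc n) ℤ.- f n

Δ^ : ℕ → (ℕ → ℤ) → ℕ → ℤ
Δ^ zero    f = f
Δ^ (suc m) f = Δ (Δ^ m f)

Δ-cong : ∀ {f h : ℕ → ℤ} → f ≗ h → Δ f ≗ Δ h
Δ-cong e zero    = e zero
Δ-cong e (suc n) = cong₂ ℤ._-_ (e (suc n)) (e n)

Δ^-cong : ∀ m {f h : ℕ → ℤ} → f ≗ h → Δ^ m f ≗ Δ^ m h
Δ^-cong zero    e = e
Δ^-cong (suc m) e = Δ-cong (Δ^-cong m e)

Δ^-Δ : ∀ m f → Δ^ m (Δ f) ≗ Δ (Δ^ m f)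
Δ^-Δ zero    f n = refl
Δ^-Δ (suc m) f n = Δ-cong (Δ^-Δ m f) n

Δ-+ : ∀ f h → Δ (λ n → f n ℤ.+ h n) ≗ λ n → Δ f n ℤ.+ Δ h n
Δ-+ f h zero    = refl
Δ-+ f h (suc n) = lem (f (suc n)) (h (suc n)) (f n) (h n)
  where lem : ∀ a b c d → (a ℤ.+ b) ℤ.- (c ℤ.+ d) ≡ (a ℤ.- c) ℤ.+ (b ℤ.- d)
        lem = ℤR.solve-∀

Δ^-+ : ∀ m f h → Δ^ m (λ n → f n ℤ.+ h n) ≗ λ n → Δ^ m f n ℤ.+ Δ^ m h n
Δ^-+ zero    f h n = refl
Δ^-+ (suc m) f h n = trans (Δ-cong (Δ^-+ m f h) n) (Δ-+ (Δ^ m f) (Δ^ m h) n)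

-- Multiplication of the generating series by `t^e`. The padding `z` is a parameter because lists of
-- points, padded by the empty list, are shifted as well as their numbers.
shift : ∀ {A : Set} → A → ℕ → (ℕ → A) → ℕ → A
shift z zero    f n       = f n
shift z (suc e) f zero    = z
shift z (suc e) f (suc n) = shift z e f n

Δ-shift : ∀ e f → Δ (shift (+ 0) e f) ≗ shift (+ 0) e (Δ f)
Δ-shift zero    f n             = refl
Δ-shift (suc e) f zero          = refl
Δ-shift (suc e) f (suc zero)    = trans (ℤ.+-identityʳ _) (Δ-shift e f zero)
Δ-shift (suc e) f (suc (suc n)) = Δ-shift e f (suc n)

Δ^-shift : ∀ m e f → Δ^ m (shift (+ 0) e f) ≗ shift (+ 0) e (Δ^ m f)
Δ^-shift zero    e f n = refl
Δ^-shift (suc m) e f n = trans (Δ-cong (Δ^-shift m e f) n) (Δ-shift e (Δ^ m f) n)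

shift-cong : ∀ {A : Set} (z : A) e {f h : ℕ → A} → f ≗ h → shift z e f ≗ shift z e h
shift-cong z zero    eq n       = eq n
shift-cong z (suc e) eq zero    = refl
shift-cong z (suc e) eq (suc n) = shift-cong z e eq n

shift-hom : ∀ {A B : Set} (φ : A → B) z e f → (λ n → φ (shift z e f n)) ≗ shift (φ z) e (λ n → φ (f n))
shift-hom φ z zero    f n       = refl
shift-hom φ z (suc e) f zero    = refl
shift-hom φ z (suc e) f (suc n) = shift-hom φ z e f n

alternating : ℕ → (ℕ → ℤ) → ℕ → ℤ
alternating m f i = Σℤ (suc i) (λ k → sgn (toℕ k) ℤ.* (+ (m C toℕ k) ℤ.* f (i ℕ.∸ toℕ k)))

-- Both sides are coefficients of the series of `f` times `(1 - t)^m`. The induction on `m` is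
-- Pascal's rule, which splits each binomial coefficient into the terms `A` and `B`.
alternating≡Δ^ : ∀ m f → alternating m f ≗ Δ^ m f
alternating≡Δ^ zero f i = trans
  (cong₂ ℤ._+_ (trans (ℤ.*-identityˡ _) (ℤ.*-identityˡ (f i)))
    (Σℤ-zero i λ k → trans (cong (λ c → sgn (suc (toℕ k)) ℤ.* (+ c ℤ.* f (i ℕ.∸ suc (toℕ k)))) (k>n⇒nCk≡0 {0} {suc (toℕ k)} (s≤s z≤n)))
      (trans (cong (sgn (suc (toℕ k)) ℤ.*_) (ℤ.*-zeroˡ (f (i ℕ.∸ suc (toℕ k))))) (ℤ.*-zeroʳ (sgn (suc (toℕ k)))))))
  (ℤ.+-identityʳ (f i))
alternating≡Δ^ (suc m) f zero    = alternating≡Δ^ m f zero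
alternating≡Δ^ (suc m) f (suc i) = begin
  alternating (suc m) f (suc i)
    ≡⟨ cong (ℤ._+_ t₀) (Σℤ-cong (suc i) pascal) ⟩
  t₀ ℤ.+ Σℤ (suc i) (λ k → A k ℤ.+ ℤ.-1ℤ ℤ.* B k)
    ≡⟨ cong (ℤ._+_ t₀) (trans (Σℤ-+ (suc i) A (λ k → ℤ.-1ℤ ℤ.* B k)) (cong (ℤ._+_ (Σℤ (suc i) A)) (Σℤ-*ˡ (suc i) ℤ.-1ℤ B))) ⟩
  t₀ ℤ.+ (Σℤ (suc i) A ℤ.+ ℤ.-1ℤ ℤ.* Σℤ (suc i) B)
    ≡⟨ ring t₀ (Σℤ (suc i) A) (Σℤ (suc i) B) ⟩
  alternating m f (suc i) ℤ.- alternating m f i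
    ≡⟨ cong₂ ℤ._-_ (alternating≡Δ^ m f (suc i)) (alternating≡Δ^ m f i) ⟩
  Δ^ m f (suc i) ℤ.- Δ^ m f i ∎
  where
  open ≡-Reasoning
  t₀ = sgn 0 ℤ.* (+ 1 ℤ.* f (suc i))
  A B : Fin (suc i) → ℤ
  A k = sgn (suc (toℕ k)) ℤ.* (+ (m C suc (toℕ k)) ℤ.* f (i ℕ.∸ toℕ k))
  B k = sgn (toℕ k) ℤ.* (+ (m C toℕ k) ℤ.* f (i ℕ.∸ toℕ k))
  ring : ∀ t a b → t ℤ.+ (a ℤ.+ ℤ.-1ℤ ℤ.* b) ≡ (t ℤ.+ a) ℤ.- b
  ring = ℤR.solve-∀
  ring′ : ∀ s p q y → (ℤ.- s) ℤ.* ((p ℤ.+ q) ℤ.* y) ≡ (ℤ.- s) ℤ.* (q ℤ.* y) ℤ.+ ℤ.-1ℤ ℤ.* (s ℤ.* (p ℤ.* y))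
  ring′ = ℤR.solve-∀
  pascal : ∀ k → sgn (suc (toℕ k)) ℤ.* (+ (suc m C suc (toℕ k)) ℤ.* f (i ℕ.∸ toℕ k)) ≡ A k ℤ.+ ℤ.-1ℤ ℤ.* B k
  pascal k = trans (cong (λ c → sgn (suc (toℕ k)) ℤ.* (+ c ℤ.* f (i ℕ.∸ toℕ k))) (sym (nCk+nC[k+1]≡[n+1]C[k+1] m (toℕ k))))
    (ring′ (sgn (toℕ k)) (+ (m C toℕ k)) (+ (m C suc (toℕ k))) (f (i ℕ.∸ toℕ k)))

δ≡Δ^ : ∀ d L → δ d L ≗ Δ^ (suc d) (λ n → + L n)
δ≡Δ^ d L i = trans (Σℤ-cong (suc i) (λ k → cong (sgn (toℕ k) ℤ.*_) (ℤ.pos-* (suc d C toℕ k) (L (i ℕ.∸ toℕ k)))))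
  (alternating≡Δ^ (suc d) (λ n → + L n) i)

bump : ∀ {m} → Vec ℕ (suc m) → Vec ℕ (suc m)
bump (x ∷ a) = suc x ∷ a

-- Weak compositions of `n` into `m` parts. Either the first part is 0 or it is raised by one from a
-- composition of a smaller number; the lengths then obey the recurrence behind `Δ-count`, and no
-- binomial formula is required.
compositions : ∀ m → ℕ → List (Vec ℕ m)
compositions zero    zero    = [] List.∷ List.[]
compositions zero    (suc n) = List.[]
compositions (suc m) zero    = List.map (0 ∷_) (compositions m zero)
compositions (suc m) (suc n) = List.map (0 ∷_) (compositions m (suc n)) List.++ List.map bump (compositions (suc m) n)

∈-compositions⁺ : ∀ {m n} (a : Vec ℕ m) → sum a ≡ n → a ∈ compositions m n
∈-compositions⁺                 []          refl = here refl
∈-compositions⁺ {suc m} {zero}  (zero ∷ a)  e    = ∈-map⁺ (0 ∷_) (∈-compositions⁺ a e)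
∈-compositions⁺ {suc m} {suc n} (zero ∷ a)  e    = ∈-++⁺ˡ (∈-map⁺ (0 ∷_) (∈-compositions⁺ a e))
∈-compositions⁺ {suc m} {suc n} (suc x ∷ a) e    =
  ∈-++⁺ʳ (List.map (0 ∷_) (compositions m (suc n))) (∈-map⁺ bump (∈-compositions⁺ (x ∷ a) (ℕ.suc-injective e)))

∈-compositions⁻ : ∀ {m n} {a : Vec ℕ m} → a ∈ compositions m n → sum a ≡ n
∈-compositions⁻ {zero}  {zero}  (here refl) = refl
∈-compositions⁻ {suc m} {zero}  a∈ with b , b∈ , refl ← ∈-map⁻ (0 ∷_) a∈ = ∈-compositions⁻ b∈
∈-compositions⁻ {suc m} {suc n} a∈ with ∈-++⁻ (List.map (0 ∷_) (compositions m (suc n))) a∈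
... | inj₁ a∈ˡ with b , b∈ , refl ← ∈-map⁻ (0 ∷_) a∈ˡ = ∈-compositions⁻ b∈
... | inj₂ a∈ʳ with x ∷ b , b∈ , refl ← ∈-map⁻ bump a∈ʳ = cong suc (∈-compositions⁻ b∈)

compositions-unique : ∀ m n → Unique (compositions m n)
compositions-unique zero    zero    = [] ∷ []
compositions-unique zero    (suc n) = []
compositions-unique (suc m) zero    = Unique.map⁺ (cong tail) (compositions-unique m zero)
compositions-unique (suc m) (suc n) = Unique.++⁺
  (Unique.map⁺ (cong tail) (compositions-unique m (suc n)))
  (Unique.map⁺ bump-injective (compositions-unique (suc m) n))
  disjoint
  where
  bump-injective : ∀ {x y : Vec ℕ (suc m)} → bump x ≡ bump y → x ≡ y
  bump-injective {x ∷ a} {y ∷ b} refl = refl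
  disjoint : ∀ {a} → ¬ (a ∈ List.map (0 ∷_) (compositions m (suc n)) × a ∈ List.map bump (compositions (suc m) n))
  disjoint (m₁ , m₂) with _ , _ , refl ← ∈-map⁻ (0 ∷_) m₁ | (_ ∷ _) , _ , () ← ∈-map⁻ bump m₂

count : ℕ → ℕ → ℤ
count m n = + length (compositions m n)

Δ-count : ∀ m → Δ (count (suc m)) ≗ count m
Δ-count m zero    = cong +_ (length-map (0 ∷_) (compositions m zero))
Δ-count m (suc n) = trans (cong (ℤ._- count (suc m) n) (cong +_ (trans (length-++ (List.map (0 ∷_) (compositions m (suc n))))
  (cong₂ ℕ._+_ (length-map (0 ∷_) (compositions m (suc n))) (length-map bump (compositions (suc m) n))))))
  (lem (count m (suc n)) (count (suc m) n))
  where lem : ∀ x y → x ℤ.+ y ℤ.- y ≡ x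
        lem = ℤR.solve-∀

-- `count m` lists the coefficients of `1 / (1 - t)^m`, and `count 0` those of the constant series
-- 1.
Δ^-count : ∀ m → Δ^ m (count m) ≗ count 0
Δ^-count zero    n = refl
Δ^-count (suc m) n = trans (sym (Δ^-Δ m (count (suc m)) n)) (trans (Δ^-cong m (Δ-count m) n) (Δ^-count m n))

shift-count-≡ : ∀ e → shift (+ 0) e (count 0) e ≡ + 1
shift-count-≡ zero    = refl
shift-count-≡ (suc e) = shift-count-≡ e

shift-count-≢ : ∀ e n → e ≢ n → shift (+ 0) e (count 0) n ≡ + 0
shift-count-≢ zero    zero    h = ⊥-elim (h refl)
shift-count-≢ zero    (suc n) h = refl
shift-count-≢ (suc e) zero    h = refl
shift-count-≢ (suc e) (suc n) h = shift-count-≢ e n (h ∘ cong suc)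

module _ {A : Set} {f : ℕ → List A} where
  ∈-shift⁺ : ∀ e {m x} → x ∈ f m → x ∈ shift List.[] e f (e ℕ.+ m)
  ∈-shift⁺ zero    x∈ = x∈
  ∈-shift⁺ (suc e) x∈ = ∈-shift⁺ e x∈

  ∈-shift⁻ : ∀ e {n x} → x ∈ shift List.[] e f n → ∃ λ m → e ℕ.+ m ≡ n × x ∈ f m
  ∈-shift⁻ zero    {n}     x∈ = n , refl , x∈
  ∈-shift⁻ (suc e) {suc n} x∈ with m , eq , x∈′ ← ∈-shift⁻ e x∈ = m , cong suc eq , x∈′

  shift-unique : ∀ e → (∀ n → Unique (f n)) → ∀ n → Unique (shift List.[] e f n)
  shift-unique zero    h n       = h n
  shift-unique (suc e) h zero    = []
  shift-unique (suc e) h (suc n) = shift-unique e h n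

x*[y*D]-cancel : ∀ a b c D → (a ℚ.* b ℚ.+ c) ℚ.* D ℚ.- b ℚ.* (a ℚ.* D) ≡ c ℚ.* D
x*[y*D]-cancel a b c D = begin
  (a ℚ.* b ℚ.+ c) ℚ.* D ℚ.- b ℚ.* (a ℚ.* D)
    ≡⟨ cong₂ ℚ._-_ (ℚ.*-distribʳ-+ D (a ℚ.* b) c) (trans (sym (ℚ.*-assoc b a D)) (cong (ℚ._* D) (ℚ.*-comm b a))) ⟩
  (a ℚ.* b ℚ.* D ℚ.+ c ℚ.* D) ℚ.- a ℚ.* b ℚ.* D
    ≡⟨ cong (ℚ._- (a ℚ.* b ℚ.* D)) (ℚ.+-comm (a ℚ.* b ℚ.* D) (c ℚ.* D)) ⟩
  (c ℚ.* D ℚ.+ a ℚ.* b ℚ.* D) ℚ.- a ℚ.* b ℚ.* D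
    ≡⟨ ℚ.+-assoc (c ℚ.* D) _ _ ⟩
  c ℚ.* D ℚ.+ (a ℚ.* b ℚ.* D ℚ.- a ℚ.* b ℚ.* D)
    ≡⟨ trans (cong (c ℚ.* D ℚ.+_) (ℚ.+-inverseʳ (a ℚ.* b ℚ.* D))) (ℚ.+-identityʳ _) ⟩
  c ℚ.* D ∎
  where open ≡-Reasoning

-- The simplex and its lattice points

module ExtremalSimplex
  (d g : ℕ) (w : Vec ℕ d) (w≤1 : ∀ i → w ! i ℕ.≤ 1) (Σw : sum w ≡ suc (suc g))
  (1≤g : 1 ℕ.≤ g) (j≤d : suc g ℕ.≤ d) where

  -- `g` is `j - 1`, so the denominator `D` is `+ j` by definition.
  open Clear g

  j : ℕ
  j = suc g

  v : Fin (suc d) → Pt (suc d)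
  v zero    = + j ∷ map +_ w
  v (suc i) = + 0 ∷ map +_ (unit i)

  -- the barycentric coordinates multiplied by j
  num : Pt (suc d) → Fin (suc d) → ℤ
  num (x₀ ∷ x) zero    = x₀
  num (x₀ ∷ x) (suc i) = D ℤ.* (x ! i) ℤ.- + (w ! i) ℤ.* x₀

  -- The linear form with value 1 at every vertex: `(j + 1) - j` at `(j , w)`, and 1 at the unit
  -- vectors.
  height : Pt (suc d) → ℤ
  height (x₀ ∷ x) = total x ℤ.- x₀

  comb-zero : ∀ (λs : Fin (suc d) → ℚ) → Σℚ (suc d) (λ i → λs i ℚ.* toℚ (v i ! zero)) ≡ λs zero ℚ.* toℚ D
  comb-zero λs = trans (cong (λs zero ℚ.* toℚ D ℚ.+_) (Σℚ-zero d λ i → ℚ.*-zeroʳ (λs (suc i))))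
    (ℚ.+-identityʳ _)

  comb-suc : ∀ λs c → Σℚ (suc d) (λ i → λs i ℚ.* toℚ (v i ! suc c)) ≡
                      λs zero ℚ.* toℚ (+ (w ! c)) ℚ.+ λs (suc c)
  comb-suc λs c = cong₂ (λ z r → λs zero ℚ.* toℚ z ℚ.+ r) (lookup-map c +_ w) (Σℚ-unit (λs ∘ suc) c)

  toℚ-num : ∀ x₀ x (b : ℤ) → toℚ (D ℤ.* x ℤ.- b ℤ.* x₀) ≡ toℚ x ℚ.* toℚ D ℚ.- toℚ b ℚ.* toℚ x₀
  toℚ-num x₀ x b = trans (toℚ-+ (D ℤ.* x) (ℤ.- (b ℤ.* x₀)))
    (cong₂ ℚ._+_ (trans (toℚ-* D x) (ℚ.*-comm (toℚ D) (toℚ x)))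
                 (trans (toℚ-neg (b ℤ.* x₀)) (cong ℚ.-_ (toℚ-* b x₀))))

  -- The equations read `x₀ = j λ₀` and `xᵢ = wᵢ λ₀ + λᵢ`. Multiplying the second by `j` and
  -- eliminating `λ₀` gives `j λᵢ = j xᵢ − wᵢ x₀`.
  comb⇒num : ∀ λs x → CombEq (suc d) λs v x → ∀ i → λs i ℚ.* toℚ D ≡ toℚ (num x i)
  comb⇒num λs (x₀ ∷ x) e zero    = trans (sym (comb-zero λs)) (e zero)
  comb⇒num λs (x₀ ∷ x) e (suc i) = sym (begin
    toℚ (D ℤ.* (x ! i) ℤ.- + (w ! i) ℤ.* x₀)
      ≡⟨ toℚ-num x₀ (x ! i) (+ (w ! i)) ⟩
    toℚ (x ! i) ℚ.* toℚ D ℚ.- toℚ (+ (w ! i)) ℚ.* toℚ x₀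
      ≡⟨ cong₂ (λ y z → y ℚ.* toℚ D ℚ.- toℚ (+ (w ! i)) ℚ.* z)
           (trans (sym (e (suc i))) (comb-suc λs i)) (trans (sym (e zero)) (comb-zero λs)) ⟩
    (λs zero ℚ.* toℚ (+ (w ! i)) ℚ.+ λs (suc i)) ℚ.* toℚ D ℚ.- toℚ (+ (w ! i)) ℚ.* (λs zero ℚ.* toℚ D)
      ≡⟨ x*[y*D]-cancel (λs zero) (toℚ (+ (w ! i))) (λs (suc i)) (toℚ D) ⟩
    λs (suc i) ℚ.* toℚ D ∎)
    where open ≡-Reasoning

  num⇒comb : ∀ λs x → (∀ i → λs i ℚ.* toℚ D ≡ toℚ (num x i)) → CombEq (suc d) λs v x
  num⇒comb λs (x₀ ∷ x) e zero    = trans (comb-zero λs) (e zero)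
  num⇒comb λs (x₀ ∷ x) e (suc i) = trans (comb-suc λs i) (*D-injective (begin
    (λs zero ℚ.* B ℚ.+ λs (suc i)) ℚ.* toℚ D
      ≡⟨ x≡y+[x-y] _ (B ℚ.* (λs zero ℚ.* toℚ D)) ⟩
    B ℚ.* (λs zero ℚ.* toℚ D) ℚ.+ ((λs zero ℚ.* B ℚ.+ λs (suc i)) ℚ.* toℚ D ℚ.- B ℚ.* (λs zero ℚ.* toℚ D))
      ≡⟨ cong₂ (λ y z → B ℚ.* y ℚ.+ z) (e zero)
           (trans (x*[y*D]-cancel (λs zero) B (λs (suc i)) (toℚ D)) (trans (e (suc i)) (toℚ-num x₀ (x ! i) (+ (w ! i))))) ⟩
    B ℚ.* toℚ x₀ ℚ.+ (toℚ (x ! i) ℚ.* toℚ D ℚ.- B ℚ.* toℚ x₀)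
      ≡⟨ x≡y+[x-y] _ (B ℚ.* toℚ x₀) ⟨
    toℚ (x ! i) ℚ.* toℚ D ∎))
    where
    open ≡-Reasoning
    B = toℚ (+ (w ! i))
    x≡y+[x-y] : ∀ x y → x ≡ y ℚ.+ (x ℚ.- y)
    x≡y+[x-y] x y = sym (trans (ℚ.+-comm y _) (trans (ℚ.+-assoc x (ℚ.- y) y)
      (trans (cong (x ℚ.+_) (ℚ.+-inverseˡ y)) (ℚ.+-identityʳ x))))

  -- The `j + 1` ones of `w` give `x₀` the coefficient `1 - (j + 1) = -j`, so `D` factors out.
  Σ-num : ∀ x → Σℤ (suc d) (num x) ≡ height x ℤ.* D
  Σ-num (x₀ ∷ x) = begin
    x₀ ℤ.+ Σℤ d (λ i → D ℤ.* (x ! i) ℤ.- + (w ! i) ℤ.* x₀)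
      ≡⟨ cong (ℤ._+_ x₀) (lem x w) ⟩
    x₀ ℤ.+ (D ℤ.* total x ℤ.- + (sum w) ℤ.* x₀)
      ≡⟨ cong (λ s → x₀ ℤ.+ (D ℤ.* total x ℤ.- + s ℤ.* x₀)) Σw ⟩
    x₀ ℤ.+ (D ℤ.* total x ℤ.- (+ 1 ℤ.+ D) ℤ.* x₀)
      ≡⟨ ring x₀ D (total x) ⟩
    (total x ℤ.- x₀) ℤ.* D ∎
    where
    open ≡-Reasoning
    ring : ∀ x₀ D t → x₀ ℤ.+ (D ℤ.* t ℤ.- (+ 1 ℤ.+ D) ℤ.* x₀) ≡ (t ℤ.- x₀) ℤ.* D
    ring = ℤR.solve-∀
    step : ∀ D x₀ y b t s → (D ℤ.* y ℤ.- b ℤ.* x₀) ℤ.+ (D ℤ.* t ℤ.- s ℤ.* x₀) ≡ D ℤ.* (y ℤ.+ t) ℤ.- (b ℤ.+ s) ℤ.* x₀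
    step = ℤR.solve-∀
    base : ∀ D x₀ → + 0 ≡ D ℤ.* + 0 ℤ.- + 0 ℤ.* x₀
    base = ℤR.solve-∀
    lem : ∀ {n} (x : Vec ℤ n) (w : Vec ℕ n) →
          Σℤ n (λ i → D ℤ.* (x ! i) ℤ.- + (w ! i) ℤ.* x₀) ≡ D ℤ.* total x ℤ.- + (sum w) ℤ.* x₀
    lem []      []      = base D x₀
    lem (y ∷ x) (b ∷ w) = trans (cong (ℤ._+_ (D ℤ.* y ℤ.- + b ℤ.* x₀)) (lem x w)) (step D x₀ y (+ b) (total x) (+ sum w))

  comb-height : ∀ λs x → CombEq (suc d) λs v x → Σℚ (suc d) λs ≡ toℚ (height x)
  comb-height λs x e = *D-injective (begin
    Σℚ (suc d) λs ℚ.* toℚ D              ≡⟨ Σℚ-*ʳ (suc d) λs (toℚ D) ⟨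
    Σℚ (suc d) (λ i → λs i ℚ.* toℚ D)    ≡⟨ Σℚ-cong (suc d) (comb⇒num λs x e) ⟩
    Σℚ (suc d) (λ i → toℚ (num x i))     ≡⟨ toℚ-Σ (suc d) (num x) ⟨
    toℚ (Σℤ (suc d) (num x))             ≡⟨ cong toℚ (Σ-num x) ⟩
    toℚ (height x ℤ.* D)                 ≡⟨ toℚ-* (height x) D ⟩
    toℚ (height x) ℚ.* toℚ D             ∎)
    where open ≡-Reasoning

  coords : Pt (suc d) → Fin (suc d) → ℚ
  coords x i = toℚ (num x i) ℚ.* D⁻¹

  coords-*D : ∀ x i → coords x i ℚ.* toℚ D ≡ toℚ (num x i)
  coords-*D x i = *D-cancel (toℚ (num x i))

  coords-comb : ∀ x → CombEq (suc d) (coords x) v x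
  coords-comb x = num⇒comb (coords x) x (coords-*D x)

  coords-unique : ∀ λs x → CombEq (suc d) λs v x → ∀ i → λs i ≡ coords x i
  coords-unique λs x e i = *D-injective (trans (comb⇒num λs x e i) (sym (coords-*D x i)))

  Cone : Pt (suc d) → Set
  Cone x = ∀ i → + 0 ℤ.≤ num x i

  -- With its converse `⇒inCone`, this replaces rational coefficients by integer inequalities, from
  -- which the lattice points can be enumerated.
  inCone⇒ : ∀ x n → InCone (suc d) v (x , n) → Cone x × height x ≡ n
  inCone⇒ x n (λs , λ≥0 , Σλ , e) =
    (λ i → 0≤-numerator (comb⇒num λs x e i) (λ≥0 i)) ,
    toℚ-injective (trans (sym (comb-height λs x e)) Σλ)

  ⇒inCone : ∀ x n → Cone x → height x ≡ n → InCone (suc d) v (x , n)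
  ⇒inCone x n c h = coords x , (λ i → 0≤-quotient (coords-*D x i) (c i)) ,
    trans (comb-height (coords x) x (coords-comb x)) (cong toℚ h) , coords-comb x

  -- Class 0 stands for the origin and class s > 0 for the box point (s , w)
  u : ℕ → ℕ
  u zero    = 0
  u (suc _) = 1

  dg : ℕ → ℕ
  dg zero    = 0
  dg (suc s) = j ℕ.∸ s

  -- The height of the representative `(s , u s · w)` is `u s (j + 1) − s`; the additive form avoids
  -- truncated subtraction and covers both kinds of classes.
  dg+s : ∀ s → s ℕ.≤ j → dg s ℕ.+ s ≡ u s ℕ.* suc j
  dg+s zero    _   = refl
  dg+s (suc s) s≤j = trans (ℕ.+-suc (j ℕ.∸ s) s)
    (trans (cong suc (ℕ.m∸n+n≡m (ℕ.<⇒≤ s≤j))) (sym (ℕ.*-identityˡ (suc j))))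

  s≤u*j : ∀ s → s ℕ.≤ j → s ℕ.≤ u s ℕ.* j
  s≤u*j zero    _   = z≤n
  s≤u*j (suc s) s≤j = ℕ.≤-trans s≤j (ℕ.≤-reflexive (sym (ℕ.*-identityˡ j)))

  ptTail : ∀ {n} → ℕ → Vec ℕ n → Vec ℕ n → Vec ℤ n
  ptTail c = zipWith (λ ω b → + (ω ℕ.* c ℕ.+ b))

  -- The representative `(s , u s · w)` plus `a₀` times the vertex `(j , w)` plus `a` on the unit
  -- vectors; together `u s + a₀` copies of `w` occur.
  pt : ℕ → Vec ℕ (suc d) → Pt (suc d)
  pt s (a₀ ∷ a) = + (s ℕ.+ a₀ ℕ.* j) ∷ ptTail (u s ℕ.+ a₀) w a

  total-ptTail : ∀ {n} c (ω a : Vec ℕ n) → total (ptTail c ω a) ≡ + (sum ω ℕ.* c ℕ.+ sum a)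
  total-ptTail c []      []      = refl
  total-ptTail c (x ∷ ω) (y ∷ a) =
    trans (cong (ℤ._+_ (+ (x ℕ.* c ℕ.+ y))) (total-ptTail c ω a)) (cong +_ (lem x c y (sum ω) (sum a)))
    where lem : ∀ x c y ω a → x ℕ.* c ℕ.+ y ℕ.+ (ω ℕ.* c ℕ.+ a) ≡ (x ℕ.+ ω) ℕ.* c ℕ.+ (y ℕ.+ a)
          lem = ℕR.solve-∀

  total-pt : ∀ s a₀ (a : Vec ℕ d) → s ℕ.≤ j →
    sum w ℕ.* (u s ℕ.+ a₀) ℕ.+ sum a ≡ (dg s ℕ.+ (a₀ ℕ.+ sum a)) ℕ.+ (s ℕ.+ a₀ ℕ.* j)
  total-pt s a₀ a s≤j = begin
    sum w ℕ.* (u s ℕ.+ a₀) ℕ.+ sum a                ≡⟨ cong (λ z → z ℕ.* (u s ℕ.+ a₀) ℕ.+ sum a) Σw ⟩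
    suc j ℕ.* (u s ℕ.+ a₀) ℕ.+ sum a                ≡⟨ r₁ j (u s) a₀ (sum a) ⟩
    u s ℕ.* suc j ℕ.+ (a₀ ℕ.+ a₀ ℕ.* j ℕ.+ sum a)   ≡⟨ cong (ℕ._+ (a₀ ℕ.+ a₀ ℕ.* j ℕ.+ sum a)) (dg+s s s≤j) ⟨
    dg s ℕ.+ s ℕ.+ (a₀ ℕ.+ a₀ ℕ.* j ℕ.+ sum a)      ≡⟨ r₂ (dg s) s a₀ (a₀ ℕ.* j) (sum a) ⟩
    (dg s ℕ.+ (a₀ ℕ.+ sum a)) ℕ.+ (s ℕ.+ a₀ ℕ.* j)  ∎
    where
    open ≡-Reasoning
    r₁ : ∀ j u a s → suc j ℕ.* (u ℕ.+ a) ℕ.+ s ≡ u ℕ.* suc j ℕ.+ (a ℕ.+ a ℕ.* j ℕ.+ s)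
    r₁ = ℕR.solve-∀
    r₂ : ∀ d s a b t → d ℕ.+ s ℕ.+ (a ℕ.+ b ℕ.+ t) ≡ (d ℕ.+ (a ℕ.+ t)) ℕ.+ (s ℕ.+ b)
    r₂ = ℕR.solve-∀

  height-pt : ∀ s a → s ℕ.≤ j → height (pt s a) ≡ + (dg s ℕ.+ sum a)
  height-pt s (a₀ ∷ a) s≤j = trans
    (cong (ℤ._- + (s ℕ.+ a₀ ℕ.* j)) (trans (total-ptTail (u s ℕ.+ a₀) w a) (cong +_ (total-pt s a₀ a s≤j))))
    (ring (+ (dg s ℕ.+ (a₀ ℕ.+ sum a))) (+ (s ℕ.+ a₀ ℕ.* j)))
    where
    ring : ∀ x y → x ℤ.+ y ℤ.- y ≡ x
    ring = ℤR.solve-∀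

  cone-pt : ∀ s a → s ℕ.≤ j → Cone (pt s a)
  cone-pt s (a₀ ∷ a) s≤j zero    = ℤ.+≤+ z≤n
  cone-pt s (a₀ ∷ a) s≤j (suc i) = subst (λ z → + 0 ℤ.≤ D ℤ.* z ℤ.- + (w ! i) ℤ.* + (s ℕ.+ a₀ ℕ.* j))
    (sym (lookup-zipWith _ i w a))
    (ℤ.i≤j⇒0≤j-i (subst₂ ℤ._≤_ (ℤ.pos-* (w ! i) _) (ℤ.pos-* j _) (ℤ.+≤+ (begin
      (w ! i) ℕ.* (s ℕ.+ a₀ ℕ.* j)               ≤⟨ ℕ.*-monoʳ-≤ (w ! i) (ℕ.+-monoˡ-≤ (a₀ ℕ.* j) (s≤u*j s s≤j)) ⟩
      (w ! i) ℕ.* (u s ℕ.* j ℕ.+ a₀ ℕ.* j)       ≡⟨ ring (w ! i) (u s) a₀ j ⟩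
      j ℕ.* ((w ! i) ℕ.* (u s ℕ.+ a₀))           ≤⟨ ℕ.*-monoʳ-≤ j (ℕ.m≤m+n _ (a ! i)) ⟩
      j ℕ.* ((w ! i) ℕ.* (u s ℕ.+ a₀) ℕ.+ (a ! i)) ∎))))
    where
    open ℕ.≤-Reasoning
    ring : ∀ w u a j → w ℕ.* (u ℕ.* j ℕ.+ a ℕ.* j) ≡ j ℕ.* (w ℕ.* (u ℕ.+ a))
    ring = ℕR.solve-∀

  -- For a residue `s`, `u s` is `s / j` rounded up, so the integer `y` is bounded by the rounded
  -- quotient.
  ceil : ∀ s q y → s ℕ.+ q ℕ.* j ℕ.≤ j ℕ.* y → u s ℕ.+ q ℕ.≤ y
  ceil zero    q y h = ℕ.*-cancelʳ-≤ q y j (ℕ.≤-trans h (ℕ.≤-reflexive (ℕ.*-comm j y)))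
  ceil (suc s) q y h = ℕ.*-cancelʳ-< j q y
    (ℕ.<-≤-trans (s≤s (ℕ.m≤n+m (q ℕ.* j) s)) (ℕ.≤-trans h (ℕ.≤-reflexive (ℕ.*-comm j y))))

  -- Here the entries 0 and 1 of `w` matter: for `ω = 0` the bound is just `x ≥ 0`, for `ω = 1` it
  -- is the one from `ceil`. The surplus `b` becomes the coefficient of a unit vector.
  excess : ∀ s q ω x → ω ℕ.≤ 1 → + 0 ℤ.≤ D ℤ.* x ℤ.- + ω ℤ.* + (s ℕ.+ q ℕ.* j) →
           ∃ λ b → x ≡ + (ω ℕ.* (u s ℕ.+ q) ℕ.+ b)
  excess s q ω x ω≤1 h = go ω≤1 x (ℤ.0≤i-j⇒j≤i h)
    where
    D*x≥0 : ∀ x z → + z ℤ.≤ D ℤ.* x → ∃ λ y → x ≡ + y × z ℕ.≤ j ℕ.* y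
    D*x≥0 (+ y) z h = y , refl , ℤ.drop‿+≤+ (subst (+ z ℤ.≤_) (sym (ℤ.pos-* j y)) h)
    go : ∀ {ω} → ω ℕ.≤ 1 → ∀ x → + ω ℤ.* + (s ℕ.+ q ℕ.* j) ℤ.≤ D ℤ.* x → ∃ λ b → x ≡ + (ω ℕ.* (u s ℕ.+ q) ℕ.+ b)
    go z≤n       x h with y , e , _ ← D*x≥0 x 0 h = y , e
    go (s≤s z≤n) x h with y , e , l ← D*x≥0 x _ (subst (ℤ._≤ D ℤ.* x) (ℤ.*-identityˡ (+ (s ℕ.+ q ℕ.* j))) h) =
      y ℕ.∸ (u s ℕ.+ q) , trans e (cong +_ (sym (trans
        (cong (ℕ._+ (y ℕ.∸ (u s ℕ.+ q))) (ℕ.*-identityˡ (u s ℕ.+ q))) (ℕ.m+[n∸m]≡n (ceil s q y l)))))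

  -- Division of `x₀` by `j`: the remainder is the class, the quotient is the coefficient of
  -- `(j , w)`.
  cone⇒pt : ∀ x → Cone x → ∃ λ s → ∃ λ a → s ℕ.< j × x ≡ pt s a
  cone⇒pt (x₀ ∷ x) c with x₀ | c zero | c ∘ suc
  ... | + X | _ | c⁺ = s , q ∷ proj₁ tails , ℕ.m%n<n X j , cong₂ _∷_ (cong +_ X≡) (proj₂ tails)
    where
    s = X ℕ.% j
    q = X ℕ./ j
    X≡ : X ≡ s ℕ.+ q ℕ.* j
    X≡ = ℕ.m≡m%n+[m/n]*n X j
    go : ∀ {n} (ω : Vec ℕ n) (x : Vec ℤ n) → (∀ i → ω ! i ℕ.≤ 1) →
         (∀ i → + 0 ℤ.≤ D ℤ.* (x ! i) ℤ.- + (ω ! i) ℤ.* + (s ℕ.+ q ℕ.* j)) →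
         ∃ λ a → x ≡ ptTail (u s ℕ.+ q) ω a
    go []      []      h k = [] , refl
    go (o ∷ ω) (y ∷ x) h k
      with b , e ← excess s q o y (h zero) (k zero) | a , es ← go ω x (h ∘ suc) (k ∘ suc)
      = b ∷ a , cong₂ _∷_ e es
    tails = go w x w≤1 (λ i → subst (λ z → + 0 ℤ.≤ D ℤ.* (x ! i) ℤ.- + (w ! i) ℤ.* + z) X≡ (c⁺ i))

  IsPt : Pt (suc d) → ℕ → Set
  IsPt x n = ∃ λ s → ∃ λ a → s ℕ.< j × x ≡ pt s a × dg s ℕ.+ sum a ≡ n

  cone⇒isPt : ∀ x {n} → Cone x × height x ≡ n → ∃ λ k → n ≡ + k × IsPt x k
  cone⇒isPt x (c , ht) with s , a , s<j , refl ← cone⇒pt x c =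
    dg s ℕ.+ sum a , trans (sym ht) (height-pt s a (ℕ.<⇒≤ s<j)) , s , a , s<j , refl , refl

  inCone⇒pt : ∀ x n → InCone (suc d) v (x , n) → ∃ λ k → n ≡ + k × IsPt x k
  inCone⇒pt x n h = cone⇒isPt x (inCone⇒ x n h)

  inDil⇒pt : ∀ x n → InDil (suc d) v n x → IsPt x n
  inDil⇒pt x n h = nat (inCone⇒pt x (+ n) h)
    where
    nat : (∃ λ k → + n ≡ + k × IsPt x k) → IsPt x n
    nat (k , refl , p) = p

  pt⇒inCone : ∀ s a → s ℕ.≤ j → InCone (suc d) v (pt s a , + (dg s ℕ.+ sum a))
  pt⇒inCone s a s≤j = ⇒inCone (pt s a) _ (cone-pt s a s≤j) (height-pt s a s≤j)

  isPt⇒inDil : ∀ x n → IsPt x n → InDil (suc d) v n x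
  isPt⇒inDil x n (s , a , s<j , refl , refl) = pt⇒inCone s a (ℕ.<⇒≤ s<j)

  ptTail-+ : ∀ {n} c e (ω a b : Vec ℕ n) → ptTail (c ℕ.+ e) ω (a ⊕ b) ≡ ptTail c ω a ⊞ ptTail e ω b
  ptTail-+ c e []      []      []      = refl
  ptTail-+ c e (o ∷ ω) (x ∷ a) (y ∷ b) = cong₂ _∷_ (cong +_ (lem o c e x y)) (ptTail-+ c e ω a b)
    where lem : ∀ o c e x y → o ℕ.* (c ℕ.+ e) ℕ.+ (x ℕ.+ y) ≡ o ℕ.* c ℕ.+ x ℕ.+ (o ℕ.* e ℕ.+ y)
          lem = ℕR.solve-∀

  pt-⊕ : ∀ s a b → pt s (a ⊕ b) ≡ pt s a ⊞ pt 0 b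
  pt-⊕ s (a₀ ∷ a) (b₀ ∷ b) = cong₂ _∷_ (cong +_ (lem s a₀ b₀ j))
    (trans (cong (λ c → ptTail c w (a ⊕ b)) (sym (ℕ.+-assoc (u s) a₀ b₀))) (ptTail-+ (u s ℕ.+ a₀) b₀ w a b))
    where lem : ∀ s a b j → s ℕ.+ (a ℕ.+ b) ℕ.* j ≡ s ℕ.+ a ℕ.* j ℕ.+ b ℕ.* j
          lem = ℕR.solve-∀

  pt-unit : ∀ i → pt 0 (unit i) ≡ v i
  pt-unit zero    = cong₂ _∷_ (cong +_ (ℕ.*-identityˡ j)) (go w)
    where
    go : ∀ {n} (ω : Vec ℕ n) → ptTail 1 ω (replicate n 0) ≡ map +_ ω
    go []      = refl
    go (o ∷ ω) = cong₂ _∷_ (cong +_ (trans (ℕ.+-identityʳ _) (ℕ.*-identityʳ o))) (go ω)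
  pt-unit (suc i) = cong (+ 0 ∷_) (go w (unit i))
    where
    go : ∀ {n} (ω a : Vec ℕ n) → ptTail 0 ω a ≡ map +_ a
    go []      []      = refl
    go (o ∷ ω) (x ∷ a) = cong₂ _∷_ (cong (λ z → + (z ℕ.+ x)) (ℕ.*-zeroʳ o)) (go ω a)

  pt-0 : pt 0 (replicate (suc d) 0) ≡ replicate (suc d) (+ 0)
  pt-0 = cong (+ 0 ∷_) (go w)
    where
    go : ∀ {n} (ω : Vec ℕ n) → ptTail 0 ω (replicate n 0) ≡ replicate n (+ 0)
    go []      = refl
    go (o ∷ ω) = cong₂ _∷_ (cong (λ z → + (z ℕ.+ 0)) (ℕ.*-zeroʳ o)) (go ω)

  pt-class : ∀ {s t a b} → s ℕ.< j → t ℕ.< j → pt s a ≡ pt t b → s ≡ t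
  pt-class {s} {t} {a₀ ∷ a} {b₀ ∷ b} s<j t<j e = begin
    s                           ≡⟨ residue s a₀ s<j ⟨
    (s ℕ.+ a₀ ℕ.* j) ℕ.% j      ≡⟨ cong (ℕ._% j) (ℤ.+-injective (cong (_! zero) e)) ⟩
    (t ℕ.+ b₀ ℕ.* j) ℕ.% j      ≡⟨ residue t b₀ t<j ⟩
    t                           ∎
    where
    open ≡-Reasoning
    residue : ∀ s a → s ℕ.< j → (s ℕ.+ a ℕ.* j) ℕ.% j ≡ s
    residue s a s<j = trans (ℕ.[m+kn]%n≡m%n s a j) (ℕ.m<n⇒m%n≡m s<j)

  pt-injective : ∀ {s a b} → pt s a ≡ pt s b → a ≡ b
  pt-injective {s} {a₀ ∷ a} {b₀ ∷ b} e
    with refl ← ℕ.*-cancelʳ-≡ a₀ b₀ j (ℕ.+-cancelˡ-≡ s _ _ (ℤ.+-injective (cong (_! zero) e)))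
    = cong (a₀ ∷_) (go w a b (cong tail e))
    where
    go : ∀ {n} (ω a b : Vec ℕ n) → ptTail (u s ℕ.+ a₀) ω a ≡ ptTail (u s ℕ.+ a₀) ω b → a ≡ b
    go []      []      []      e = refl
    go (o ∷ ω) (x ∷ a) (y ∷ b) e = cong₂ _∷_
      (ℕ.+-cancelˡ-≡ (o ℕ.* (u s ℕ.+ a₀)) x y (ℤ.+-injective (cong (_! zero) e)))
      (go ω a b (cong tail e))

  1<j : 1 ℕ.< j
  1<j = s≤s 1≤g

  num-0 : ∀ i → num (replicate (suc d) (+ 0)) i ≡ + 0
  num-0 zero    = refl
  num-0 (suc i) = trans (cong (λ z → D ℤ.* z ℤ.- + (w ! i) ℤ.* + 0) (lookup-replicate i (+ 0))) (ring D (+ (w ! i)))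
    where ring : ∀ D w → D ℤ.* + 0 ℤ.- w ℤ.* + 0 ≡ + 0
          ring = ℤR.solve-∀

  v-simplex : Simplex d v
  v-simplex λs _ e i = trans (coords-unique λs (replicate (suc d) (+ 0)) e i)
    (trans (cong (λ z → toℚ z ℚ.* D⁻¹) (num-0 i)) (ℚ.*-zeroˡ D⁻¹))

  -- Emptiness of the simplex rests on this: a lattice point of degree 1 must have class 0, which
  -- makes it a vertex.
  dg≥2 : ∀ s → suc s ℕ.< j → 2 ℕ.≤ dg (suc s)
  dg≥2 s s+1<j = ℕ.+-cancelʳ-≤ s 2 _ (ℕ.≤-trans s+1<j (ℕ.≤-reflexive (sym (ℕ.m∸n+n≡m (ℕ.<⇒≤ (ℕ.<-trans (ℕ.n<1+n s) s+1<j))))))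

  dg≤j : ∀ s → dg s ℕ.≤ j
  dg≤j zero    = z≤n
  dg≤j (suc s) = ℕ.m∸n≤m j s

  degree-one : ∀ x → IsPt x 1 → ∃ λ i → x ≡ v i
  degree-one x (zero  , a , _ , refl , e) with i , refl ← sum≡1⇒unit a e = i , pt-unit i
  degree-one x (suc s , a , s<j , _ , e) =
    ⊥-elim (ℕ.<⇒≱ (dg≥2 s s<j) (ℕ.≤-trans (ℕ.m≤m+n (dg (suc s)) (sum a)) (ℕ.≤-reflexive e)))

  v-empty : EmptyPoly (suc d) v
  v-empty x h = degree-one x (inDil⇒pt x 1 h)

  -- In class 0 a positive head needs `a₀ ≥ 1`, which adds 1 to the degree and `j` to the head. In a
  -- class `s > 0` the representative alone has `dg s + s = j + 1`.
  1≤head⇒j<degree+head : ∀ x n X → IsPt x n → x ! zero ≡ + X → 1 ℕ.≤ X → suc j ℕ.≤ n ℕ.+ X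
  1≤head⇒j<degree+head x n X (s , a₀ ∷ a , s<j , refl , refl) refl 1≤X = go s s<j a₀ 1≤X
    where
    open ℕ.≤-Reasoning
    go : ∀ s → s ℕ.< j → ∀ a₀ → 1 ℕ.≤ s ℕ.+ a₀ ℕ.* j → suc j ℕ.≤ dg s ℕ.+ (a₀ ℕ.+ sum a) ℕ.+ (s ℕ.+ a₀ ℕ.* j)
    go zero    _   (suc a₀) _ = ℕ.+-mono-≤ (s≤s z≤n) (ℕ.m≤m+n j (a₀ ℕ.* j))
    go (suc s) s<j a₀       _ = begin
      suc j                   ≡⟨ ℕ.*-identityˡ (suc j) ⟨
      u (suc s) ℕ.* suc j     ≡⟨ dg+s (suc s) (ℕ.<⇒≤ s<j) ⟨
      dg (suc s) ℕ.+ suc s    ≤⟨ ℕ.+-mono-≤ (ℕ.m≤m+n (dg (suc s)) _) (ℕ.m≤m+n (suc s) _) ⟩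
      dg (suc s) ℕ.+ (a₀ ℕ.+ sum a) ℕ.+ (suc s ℕ.+ a₀ ℕ.* j) ∎

  pt-head≥0 : ∀ x n → IsPt x n → + 0 ℤ.≤ x ! zero
  pt-head≥0 x n (s , a₀ ∷ a , _ , refl , _) = ℤ.+≤+ z≤n

  -- Dilates

  unit-head⇒j≤ : ∀ k r (αs : Fin r → Pt (suc d)) → (∀ i → IsPt (αs i) k) → ΣPt r αs ! zero ≡ + 1 → j ℕ.≤ k
  unit-head⇒j≤ k r αs p e
    with i , e₁ ← Σℤ≡1⇒unit-summand r (λ i → αs i ! zero) (λ i → pt-head≥0 _ k (p i)) (trans (sym (lookup-ΣPt r αs zero)) e)
    = ℕ.+-cancelʳ-≤ 1 j k (ℕ.≤-trans (ℕ.≤-reflexive (ℕ.+-comm j 1)) (1≤head⇒j<degree+head (αs i) k 1 (p i) e₁ (s≤s z≤n)))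

  ¬veryAmple : ∀ k → 1 ℕ.≤ k → k ℕ.< j → ¬ VeryAmple (suc d) (dilate k v)
  ¬veryAmple k 1≤k k<j (n₀ , decomp) = ℕ.<⇒≱ k<j
    (unit-head⇒j≤ k n (proj₁ dec) (λ i → subst (IsPt _) (ℕ.*-identityʳ k)
      (inDil⇒pt (proj₁ dec i) (k ℕ.* 1) (dilate⇒ (suc d) v k 1 (proj₁ dec i) (proj₁ (proj₂ dec) i))))
      (cong (_! zero) (proj₂ (proj₂ dec))))
    where
    -- Large enough for `n₀ ≤ n`, `1 ≤ n` and `j ≤ k n` at once.
    n = n₀ ℕ.+ j
    j≤kn : j ℕ.≤ k ℕ.* n
    j≤kn = ℕ.≤-trans (ℕ.m≤n+m j n₀) (ℕ.≤-trans (ℕ.≤-reflexive (sym (ℕ.*-identityˡ n))) (ℕ.*-monoˡ-≤ n 1≤k))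
    -- What remains of the degree after `(1 , w)`, which has degree `j`; unit vectors fill it up
    -- without changing the head.
    M = k ℕ.* n ℕ.∸ j
    a : ∃ λ (a : Vec ℕ d) → sum a ≡ M
    a = vec-with-sum w (λ e → case trans (sym e) Σw of λ ()) M
    x = pt 1 (0 ∷ proj₁ a)
    x∈ : IsPt x (k ℕ.* n)
    x∈ = 1 , 0 ∷ proj₁ a , 1<j , refl , trans (cong (j ℕ.+_) (proj₂ a)) (ℕ.m+[n∸m]≡n j≤kn)
    dec : Decomposes (suc d) (dilate k v) n x
    dec = decomp n (ℕ.m≤m+n n₀ j) (ℕ.≤-trans (s≤s z≤n) (ℕ.m≤n+m j n₀)) x
      (dilate⇐ (suc d) v k n x 1≤k (isPt⇒inDil x (k ℕ.* n) x∈))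

  -- All summands but the last are integral combinations of vertices; the last one carries the class
  -- `s`, hence the count `suc r`.
  decompose : ∀ n → j ℕ.≤ n → ∀ r s a → s ℕ.< j → dg s ℕ.+ sum a ≡ suc r ℕ.* n →
    ∃ λ (αs : Fin (suc r) → Pt (suc d)) → (∀ i → IsPt (αs i) n) × ΣPt (suc r) αs ≡ pt s a
  decompose n j≤n zero s a s<j e = (λ _ → pt s a) ,
    (λ _ → s , a , s<j , refl , trans e (ℕ.*-identityˡ n)) , zipWith-identityʳ ℤ.+-identityʳ (pt s a)
  decompose n j≤n (suc r) s a s<j e = peel (split a n n≤Σa)
    where
    -- The degree is at least `2 n`, and the class uses up at most `j ≤ n` of it.
    n≤Σa : n ℕ.≤ sum a
    n≤Σa = ℕ.+-cancelˡ-≤ n _ _ (begin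
      n ℕ.+ n               ≤⟨ ℕ.+-monoʳ-≤ n (ℕ.m≤m+n n (r ℕ.* n)) ⟩
      n ℕ.+ (n ℕ.+ r ℕ.* n) ≡⟨ e ⟨
      dg s ℕ.+ sum a        ≤⟨ ℕ.+-monoˡ-≤ (sum a) (ℕ.≤-trans (dg≤j s) j≤n) ⟩
      n ℕ.+ sum a           ∎)
      where open ℕ.≤-Reasoning
    rest : ∀ b c → b ⊕ c ≡ a → sum b ≡ n → dg s ℕ.+ sum c ≡ suc r ℕ.* n
    rest b c b⊕c Σb = ℕ.+-cancelˡ-≡ n _ _ (begin
      n ℕ.+ (dg s ℕ.+ sum c)     ≡⟨ ring n (dg s) (sum c) ⟩
      dg s ℕ.+ (n ℕ.+ sum c)     ≡⟨ cong (λ z → dg s ℕ.+ (z ℕ.+ sum c)) Σb ⟨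
      dg s ℕ.+ (sum b ℕ.+ sum c) ≡⟨ cong (dg s ℕ.+_) (trans (sym (sum-⊕ b c)) (cong sum b⊕c)) ⟩
      dg s ℕ.+ sum a             ≡⟨ e ⟩
      n ℕ.+ suc r ℕ.* n          ∎)
      where
      open ≡-Reasoning
      ring : ∀ n d c → n ℕ.+ (d ℕ.+ c) ≡ d ℕ.+ (n ℕ.+ c)
      ring = ℕR.solve-∀
    peel : (∃ λ b → ∃ λ c → b ⊕ c ≡ a × sum b ≡ n) →
      ∃ λ (αs : Fin (suc (suc r)) → Pt (suc d)) → (∀ i → IsPt (αs i) n) × ΣPt (suc (suc r)) αs ≡ pt s a
    peel (b , c , b⊕c , Σb) with αs , p , q ← decompose n j≤n r s c s<j (rest b c b⊕c Σb) =
      (λ { zero → pt 0 b ; (suc i) → αs i }) ,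
      (λ { zero → 0 , b , s≤s z≤n , refl , Σb ; (suc i) → p i }) ,
      trans (cong (pt 0 b ⊞_) q) (trans (zipWith-comm ℤ.+-comm (pt 0 b) (pt s c))
        (trans (sym (pt-⊕ s c b)) (cong (pt s) (trans (zipWith-comm ℕ.+-comm c b) b⊕c))))

  idp-dilate : ∀ n → j ℕ.≤ n → IDP (suc d) (dilate n v)
  idp-dilate n j≤n (suc r) _ α h = go (inDil⇒pt α _ (dilate⇒ (suc d) v n (suc r) α h))
    where
    go : IsPt α (n ℕ.* suc r) → Decomposes (suc d) (dilate n v) (suc r) α
    go (s , a , s<j , refl , e) with αs , p , q ← decompose n j≤n r s a s<j (trans e (ℕ.*-comm n (suc r))) =
      αs , (λ i → dilate⇐ (suc d) v n 1 (αs i) (ℕ.≤-trans (s≤s z≤n) j≤n)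
        (isPt⇒inDil (αs i) (n ℕ.* 1) (subst (IsPt (αs i)) (sym (ℕ.*-identityʳ n)) (p i)))) , q

  μ-va : MuVa (suc d) v j
  μ-va = s≤s z≤n , idp⇒veryAmple {p = dilate j v} (idp-dilate j ℕ.≤-refl) , ¬veryAmple

  μ-midp : MuMidp (suc d) v j
  μ-midp = s≤s z≤n , idp-dilate j ℕ.≤-refl ,
    λ k 1≤k k<j idp → ¬veryAmple k 1≤k k<j (idp⇒veryAmple {p = dilate k v} idp)

  μ-idp : MuIdp (suc d) v j
  μ-idp = s≤s z≤n , idp-dilate ,
    λ k 1≤k k<j idp → ¬veryAmple k 1≤k k<j (idp⇒veryAmple {p = dilate k v} (idp k ℕ.≤-refl))

  -- Holes

  v-isPt : ∀ i → IsPt (v i) 1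
  v-isPt i = 0 , unit i , s≤s z≤n , sym (pt-unit i) , sum-unit i

  v∈P : ∀ i → InPoly (suc d) v (v i)
  v∈P i = isPt⇒inDil (v i) 1 (v-isPt i)

  -- Class 1 has the largest degree among all classes, namely `j`.
  hole : Pt (suc d)
  hole = pt 1 (replicate (suc d) 0)

  hole-isPt : IsPt hole j
  hole-isPt = 1 , replicate (suc d) 0 , 1<j , refl , trans (cong (j ℕ.+_) (sum-replicate-0 d)) (ℕ.+-identityʳ j)

  -- The numerators of `(1 , w)` are 1 at the first vertex and, at the others, 0 or `j - 1`
  -- according to the entry of `w`.
  num-hole<D : ∀ i → num hole i ℤ.< D
  num-hole<D zero    = ℤ.+<+ 1<j
  num-hole<D (suc i) = subst (λ z → D ℤ.* z ℤ.- + (w ! i) ℤ.* + 1 ℤ.< D)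
    (sym (trans (lookup-zipWith _ i w (replicate d 0)) (cong (λ z → + ((w ! i) ℕ.* 1 ℕ.+ z)) (lookup-replicate i 0))))
    (go (w≤1 i))
    where
    go : ∀ {ω} → ω ℕ.≤ 1 → D ℤ.* + (ω ℕ.* 1 ℕ.+ 0) ℤ.- + ω ℤ.* + 1 ℤ.< D
    go z≤n       = subst (ℤ._< D) (r D) (ℤ.+<+ (s≤s z≤n))
      where r : ∀ D → + 0 ≡ D ℤ.* + 0 ℤ.- + 0 ℤ.* + 1
            r = ℤR.solve-∀
    go (s≤s z≤n) = subst (ℤ._< D) (r (+ g)) (ℤ.+<+ (ℕ.n<1+n g))
      where r : ∀ g → g ≡ (+ 1 ℤ.+ g) ℤ.* + 1 ℤ.- + 1 ℤ.* + 1
            r = ℤR.solve-∀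

  hole∈Box : InBox (suc d) v (hole , + j)
  hole∈Box = coords hole ,
    (λ i → 0≤-quotient (coords-*D hole i) (c i) , quotient-<1 (coords-*D hole i) (num-hole<D i)) ,
    trans (comb-height (coords hole) hole (coords-comb hole)) (cong toℚ ht) , coords-comb hole
    where
    c,ht = inCone⇒ hole (+ j) (isPt⇒inDil hole j hole-isPt)
    c = proj₁ c,ht
    ht = proj₂ c,ht

  hole∉semigroup : ¬ InSemigroup (suc d) v (hole , + j)
  hole∉semigroup (r , βs , β∈P , Σβ , _) =
    ℕ.<⇒≱ 1<j (unit-head⇒j≤ 1 r βs (λ i → inDil⇒pt (βs i) 1 (β∈P i)) (cong (_! zero) Σβ))

  -- Every coefficient in `a` adds `j` times itself to a numerator that is already non-negative, so
  -- numerators below `j` force `a` to vanish, and the degree is `dg s`.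
  num<D⇒height≤j : ∀ x n → IsPt x n → (∀ i → num x i ℤ.< D) → n ℕ.≤ j
  num<D⇒height≤j x n (s , a₀ ∷ a , s<j , refl , refl) h =
    subst (ℕ._≤ j) (sym (trans (cong (dg s ℕ.+_) Σa≡0) (ℕ.+-identityʳ (dg s)))) (dg≤j s)
    where
    <⇒≡0 : ∀ m → m ℕ.* j ℕ.< j → m ≡ 0
    <⇒≡0 m lt = ℕ.n<1⇒n≡0 (ℕ.*-cancelʳ-< j m 1 (ℕ.<-≤-trans lt (ℕ.≤-reflexive (sym (ℕ.*-identityˡ j)))))
    a₀≡0 : a₀ ≡ 0
    a₀≡0 = <⇒≡0 a₀ (ℕ.≤-<-trans (ℕ.m≤n+m (a₀ ℕ.* j) s) (ℤ.drop‿+<+ (h zero)))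
    clear : ∀ ω y a₀ → a₀ ≡ 0 → D ℤ.* + (ω ℕ.* (u s ℕ.+ a₀) ℕ.+ y) ℤ.- + ω ℤ.* + (s ℕ.+ a₀ ℕ.* j) ℤ.< D → y ≡ 0
    clear ω y .0 refl lt = <⇒≡0 y (ℕ.+-cancelʳ-< (ω ℕ.* (u s ℕ.* j)) (y ℕ.* j) j (begin-strict
      y ℕ.* j ℕ.+ ω ℕ.* (u s ℕ.* j)       ≡⟨ ring y j ω (u s) ⟩
      j ℕ.* (ω ℕ.* (u s ℕ.+ 0) ℕ.+ y)     <⟨ ℤ.drop‿+<+ lt′ ⟩
      j ℕ.+ ω ℕ.* (s ℕ.+ 0)               ≤⟨ ℕ.+-monoʳ-≤ j (ℕ.*-monoʳ-≤ ω (ℕ.≤-trans (ℕ.≤-reflexive (ℕ.+-identityʳ s)) (s≤u*j s (ℕ.<⇒≤ s<j)))) ⟩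
      j ℕ.+ ω ℕ.* (u s ℕ.* j)             ∎))
      where
      open ℕ.≤-Reasoning
      ring : ∀ y j ω u → y ℕ.* j ℕ.+ ω ℕ.* (u ℕ.* j) ≡ j ℕ.* (ω ℕ.* (u ℕ.+ 0) ℕ.+ y)
      ring = ℕR.solve-∀
      A = ω ℕ.* (u s ℕ.+ 0) ℕ.+ y
      B = ω ℕ.* (s ℕ.+ 0)
      cancel : ∀ a b → a ℤ.- b ℤ.+ b ≡ a
      cancel = ℤR.solve-∀
      lt′ : + (j ℕ.* A) ℤ.< + (j ℕ.+ B)
      lt′ = subst₂ ℤ._<_
        (trans (cancel (D ℤ.* + A) (+ ω ℤ.* + (s ℕ.+ 0))) (sym (ℤ.pos-* j A)))
        (cong (ℤ._+_ D) (sym (ℤ.pos-* ω (s ℕ.+ 0))))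
        (ℤ.+-monoˡ-< (+ ω ℤ.* + (s ℕ.+ 0)) lt)
    Σa≡0 : sum (a₀ ∷ a) ≡ 0
    Σa≡0 = cong₂ ℕ._+_ a₀≡0 (sum-zero a λ i → clear (w ! i) (a ! i) a₀ a₀≡0
      (subst (λ z → D ℤ.* z ℤ.- + (w ! i) ℤ.* + (s ℕ.+ a₀ ℕ.* j) ℤ.< D) (lookup-zipWith _ i w a) (h (suc i))))

  -- Lattice points of the polytope are its vertices, so any other empty simplex `p` inside it
  -- merely relabels them by `σ`. Affine independence makes `σ` injective, and the box coordinates
  -- carry over to `v`.
  box-degree : ∀ x → InBoxP d (suc d) v x → deg x ℤ.≤ + j
  box-degree (α , n) ((p , p-simplex , _ , p∈P , rs , rs∈ , Σrs , e) , _) = bound (inCone⇒pt α n α∈C)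
    where
    σ : Fin (suc d) → Fin (suc d)
    σ i = proj₁ (v-empty (p i) (p∈P i))
    p≡v : ∀ i → p i ≡ v (σ i)
    p≡v i = proj₂ (v-empty (p i) (p∈P i))
    σ-injective : ∀ {i k} → σ i ≡ σ k → i ≡ k
    σ-injective {i} {k} eq = affInd⇒injective p p-simplex (trans (p≡v i) (trans (cong v eq) (sym (p≡v k))))
    cs : Fin (suc d) → ℚ
    cs = pushforward σ rs
    comb : CombEq (suc d) cs v α
    comb c = trans (Σℚ-pushforward σ rs (λ k → toℚ (v k ! c)))
      (trans (Σℚ-cong (suc d) (λ i → cong (λ y → rs i ℚ.* toℚ (y ! c)) (sym (p≡v i)))) (e c))
    Σcs : Σℚ (suc d) cs ≡ toℚ n
    Σcs = begin
      Σℚ (suc d) cs                       ≡⟨ Σℚ-cong (suc d) (λ k → ℚ.*-identityʳ (cs k)) ⟨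
      Σℚ (suc d) (λ k → cs k ℚ.* 1ℚ)      ≡⟨ Σℚ-pushforward σ rs (λ _ → 1ℚ) ⟩
      Σℚ (suc d) (λ i → rs i ℚ.* 1ℚ)      ≡⟨ Σℚ-cong (suc d) (λ i → ℚ.*-identityʳ (rs i)) ⟩
      Σℚ (suc d) rs                       ≡⟨ Σrs ⟩
      toℚ n                               ∎
      where open ≡-Reasoning
    cs≥0 : ∀ k → 0ℚ ℚ.≤ cs k
    cs≥0 = pushforward-range σ rs (0ℚ ℚ.≤_) σ-injective ℚ.≤-refl (proj₁ ∘ rs∈)
    cs<1 : ∀ k → cs k ℚ.< 1ℚ
    cs<1 = pushforward-range σ rs (ℚ._< 1ℚ) σ-injective (ℚ.positive⁻¹ 1ℚ) (proj₂ ∘ rs∈)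
    α∈C : InCone (suc d) v (α , n)
    α∈C = cs , cs≥0 , Σcs , comb
    bound : (∃ λ k → n ≡ + k × IsPt α k) → n ℤ.≤ + j
    bound (k , refl , α-pt) = ℤ.+≤+ (num<D⇒height≤j α k α-pt
      (λ i → numerator-<D (comb⇒num cs α comb i) (cs<1 i)))

  μ-hole : MuHole d (suc d) v j
  μ-hole = inj₂ (((hole , + j) ,
    (((v , v-simplex , v-empty , v∈P , hole∈Box) , hole∉semigroup) , refl)) , box-degree)

  -- Hilbert basis

  InC : CPt (suc d) → Set
  InC (x , n) = Cone x × height x ≡ n

  inC-0 : InC 0ᶜ
  inC-0 = (λ i → ℤ.≤-reflexive (sym (num-0 i))) , trans (ℤ.+-identityʳ (total (replicate d (+ 0))))
    (Σℤ-zero d (λ i → lookup-replicate i (+ 0)))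

  inC-+ : ∀ {x y} → InC x → InC y → InC (x +ᶜ y)
  inC-+ {x₀ ∷ x , m} {y₀ ∷ y , n} (cx , hx) (cy , hy) =
    (λ i → subst (+ 0 ℤ.≤_) (sym (num-+ i)) (ℤ.+-mono-≤ (cx i) (cy i))) ,
    trans (cong (ℤ._- (x₀ ℤ.+ y₀)) (total-⊞ x y)) (trans (r₂ (total x) (total y) x₀ y₀) (cong₂ ℤ._+_ hx hy))
    where
    r₁ : ∀ D x y w x₀ y₀ → D ℤ.* (x ℤ.+ y) ℤ.- w ℤ.* (x₀ ℤ.+ y₀) ≡ (D ℤ.* x ℤ.- w ℤ.* x₀) ℤ.+ (D ℤ.* y ℤ.- w ℤ.* y₀)
    r₁ = ℤR.solve-∀
    r₂ : ∀ s t x y → (s ℤ.+ t) ℤ.- (x ℤ.+ y) ≡ (s ℤ.- x) ℤ.+ (t ℤ.- y)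
    r₂ = ℤR.solve-∀
    num-+ : ∀ i → num ((x₀ ∷ x) ⊞ (y₀ ∷ y)) i ≡ num (x₀ ∷ x) i ℤ.+ num (y₀ ∷ y) i
    num-+ zero    = refl
    num-+ (suc i) = trans (cong (λ z → D ℤ.* z ℤ.- + (w ! i) ℤ.* (x₀ ℤ.+ y₀)) (lookup-zipWith ℤ._+_ i x y))
      (r₁ D (x ! i) (y ! i) (+ (w ! i)) x₀ y₀)

  open Irreducibility InC inC-0 (λ {x} {y} → inC-+ {x} {y})

  inC⇒isPt : ∀ x n → InC (x , n) → ∃ λ k → n ≡ + k × IsPt x k
  inC⇒isPt x n = cone⇒isPt x

  inC⇒inCone : ∀ x → InC x → InCone (suc d) v x
  inC⇒inCone (x , n) (c , h) = ⇒inCone x n c h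

  isPt⇒inC : ∀ x k → IsPt x k → InC (x , + k)
  isPt⇒inC x k p = inCone⇒ x (+ k) (isPt⇒inDil x k p)

  degree-zero : ∀ x → IsPt x 0 → x ≡ replicate (suc d) (+ 0)
  degree-zero x (zero  , a , _ , refl , e) = trans (cong (pt 0) (sum≡0⇒replicate a e)) pt-0
  degree-zero x (suc s , a , s<j , _ , e) =
    case ℕ.≤-trans (dg≥2 s s<j) (ℕ.≤-reflexive (ℕ.m+n≡0⇒m≡0 (dg (suc s)) e)) of λ ()

  irreducible-degree-one : ∀ x → Irreducible (x , + 1)
  irreducible-degree-one x {y , m} {z , n} cy cz e with inC⇒isPt y m cy | inC⇒isPt z n cz
  ... | zero  , refl , p | _ , _ , _ = inj₁ (cong (_, + 0) (degree-zero y p))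
  ... | suc k , _ , _ | zero , refl , q = inj₂ (cong (_, + 0) (degree-zero z q))
  ... | suc k , refl , _ | suc l , refl , _ =
    case trans (sym (ℕ.+-suc k l)) (ℕ.suc-injective (ℤ.+-injective (cong proj₂ e))) of λ ()

  isPt-head : ∀ x k → IsPt x k → ∃ λ X → x ! zero ≡ + X
  isPt-head x k (s , a₀ ∷ a , _ , refl , _) = _ , refl

  -- Such a point attains equality in the key inequality. If one summand has head 0, the other has
  -- head `X`, hence degree at least `n`, and the first is 0. Two positive heads would give
  -- `2 (j + 1) ≤ j + 1`.
  irreducible-box : ∀ x n X → x ! zero ≡ + X → 1 ℕ.≤ X → n ℕ.+ X ≡ suc j → Irreducible (x , + n)
  irreducible-box x n X x₀ 1≤X bd {y , m₁} {z , m₂} cy cz e with inC⇒isPt y m₁ cy | inC⇒isPt z m₂ cz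
  ... | k , refl , p | l , refl , q with isPt-head y k p | isPt-head z l q
  ... | Y , eY | Z , eZ = go Y Z eY eZ
    (ℤ.+-injective (trans (sym (cong₂ ℤ._+_ eY eZ)) (trans (sym (lookup-zipWith ℤ._+_ zero y z))
      (trans (cong (λ t → proj₁ t ! zero) e) x₀))))
    where
    open ℕ.≤-Reasoning
    k+l≡n : k ℕ.+ l ≡ n
    k+l≡n = ℤ.+-injective (cong proj₂ e)
    vanish : ∀ k l → k ℕ.+ l ≡ n → suc j ℕ.≤ l ℕ.+ X → k ≡ 0
    vanish k l k+l h = ℕ.n≤0⇒n≡0 (ℕ.+-cancelʳ-≤ (l ℕ.+ X) k 0 (begin
      k ℕ.+ (l ℕ.+ X)   ≡⟨ ℕ.+-assoc k l X ⟨
      k ℕ.+ l ℕ.+ X     ≡⟨ cong (ℕ._+ X) k+l ⟩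
      n ℕ.+ X           ≡⟨ bd ⟩
      suc j             ≤⟨ h ⟩
      l ℕ.+ X           ∎))
    go : ∀ Y Z → y ! zero ≡ + Y → z ! zero ≡ + Z → Y ℕ.+ Z ≡ X → (y , + k) ≡ 0ᶜ ⊎ (z , + l) ≡ 0ᶜ
    go zero    Z       eY eZ s with refl ← vanish k l k+l≡n (1≤head⇒j<degree+head z l X q (trans eZ (cong +_ s)) 1≤X) =
      inj₁ (cong (_, + 0) (degree-zero y p))
    go (suc Y) zero    eY eZ s
      with refl ← vanish l k (trans (ℕ.+-comm l k) k+l≡n)
                    (1≤head⇒j<degree+head y k X p (trans eY (cong +_ (trans (sym (ℕ.+-identityʳ (suc Y))) s))) 1≤X) =
      inj₂ (cong (_, + 0) (degree-zero z q))
    go (suc Y) (suc Z) eY eZ s = ⊥-elim (ℕ.<⇒≱ (ℕ.m<m+n (suc j) (s≤s z≤n)) (begin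
      suc j ℕ.+ suc j                        ≤⟨ ℕ.+-mono-≤ (1≤head⇒j<degree+head y k (suc Y) p eY (s≤s z≤n)) (1≤head⇒j<degree+head z l (suc Z) q eZ (s≤s z≤n)) ⟩
      k ℕ.+ suc Y ℕ.+ (l ℕ.+ suc Z)          ≡⟨ ring k (suc Y) l (suc Z) ⟩
      k ℕ.+ l ℕ.+ (suc Y ℕ.+ suc Z)          ≡⟨ cong₂ ℕ._+_ k+l≡n s ⟩
      n ℕ.+ X                                ≡⟨ bd ⟩
      suc j                                  ∎))
      where ring : ∀ k y l z → k ℕ.+ y ℕ.+ (l ℕ.+ z) ≡ k ℕ.+ l ℕ.+ (y ℕ.+ z)
            ring = ℕR.solve-∀

  vertex : Fin (suc d) → CPt (suc d)
  vertex i = v i , + 1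

  -- Index `t` stands for class `t + 1`, so the nonzero residues `1, …, j - 1` are all covered.
  box : Fin g → CPt (suc d)
  box t = pt (suc (toℕ t)) (replicate (suc d) 0) , + dg (suc (toℕ t))

  basis : List (CPt (suc d))
  basis = List.tabulate vertex List.++ List.tabulate box

  suc-toℕ<j : ∀ (t : Fin g) → suc (toℕ t) ℕ.< j
  suc-toℕ<j t = s≤s (toℕ<n t)

  box-isPt : ∀ t → IsPt (proj₁ (box t)) (dg (suc (toℕ t)))
  box-isPt t = suc (toℕ t) , replicate (suc d) 0 , suc-toℕ<j t , refl ,
    trans (cong (dg (suc (toℕ t)) ℕ.+_) (sum-replicate-0 d)) (ℕ.+-identityʳ _)

  basis-elim : ∀ (P : CPt (suc d) → Set) → (∀ i → P (vertex i)) → (∀ t → P (box t)) → ∀ {x} → x ∈ basis → P x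
  basis-elim P pv pb x∈ with ∈-++⁻ (List.tabulate vertex) x∈
  ... | inj₁ m with i , refl ← ∈-tabulate⁻ {f = vertex} m = pv i
  ... | inj₂ m with t , refl ← ∈-tabulate⁻ {f = box} m = pb t

  basis-inC : ∀ {x} → x ∈ basis → InC x
  basis-inC = basis-elim InC (λ i → isPt⇒inC (v i) 1 (v-isPt i)) (λ t → isPt⇒inC _ _ (box-isPt t))

  basis-≢0 : ∀ {x} → x ∈ basis → x ≢ 0ᶜ
  basis-≢0 = basis-elim (_≢ 0ᶜ) (λ i e → case cong proj₂ e of λ ())
    (λ t e → case subst (2 ℕ.≤_) (ℤ.+-injective (cong proj₂ e)) (dg≥2 (toℕ t) (suc-toℕ<j t)) of λ ())

  basis-irreducible : ∀ {x} → x ∈ basis → Irreducible x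
  basis-irreducible = basis-elim Irreducible (λ i → irreducible-degree-one (v i))
    (λ t → irreducible-box _ (dg (suc (toℕ t))) (suc (toℕ t)) (cong +_ (ℕ.+-identityʳ _)) (s≤s z≤n)
      (trans (dg+s (suc (toℕ t)) (ℕ.<⇒≤ (suc-toℕ<j t))) (ℕ.*-identityˡ (suc j))))

  basis-degree : ∀ {x} → x ∈ basis → deg x ℤ.≤ + j
  basis-degree = basis-elim (λ x → deg x ℤ.≤ + j) (λ _ → ℤ.+≤+ (s≤s z≤n)) (λ t → ℤ.+≤+ (dg≤j (suc (toℕ t))))

  basis-unique : Unique basis
  basis-unique = Unique.++⁺
    (Unique.tabulate⁺ {f = vertex} (λ e → affInd⇒injective v v-simplex (cong proj₁ e)))
    (Unique.tabulate⁺ {f = box} (λ {t} {t′} e → toℕ-injective (ℕ.suc-injective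
      (pt-class (suc-toℕ<j t) (suc-toℕ<j t′) (cong proj₁ e)))))
    disjoint
    where
    disjoint : ∀ {x} → ¬ (x ∈ List.tabulate vertex × x ∈ List.tabulate box)
    disjoint (m₁ , m₂) with i , refl ← ∈-tabulate⁻ {f = vertex} m₁ | t , e ← ∈-tabulate⁻ {f = box} m₂ =
      ℕ.<⇒≱ (dg≥2 (toℕ t) (suc-toℕ<j t)) (ℕ.≤-reflexive (sym (ℤ.+-injective (cong proj₂ e))))

  generated-integral : ∀ k a → sum a ≡ k → Generated basis (pt 0 a , + k)
  generated-integral zero a e = subst (Generated basis)
    (cong (_, + 0) (sym (trans (cong (pt 0) (sum≡0⇒replicate a e)) pt-0))) (generated-0 basis)
  -- All but one unit of `a` is split off; what is left is a unit vector, that is, a vertex.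
  generated-integral (suc k) a e with split a k (ℕ.≤-trans (ℕ.n≤1+n k) (ℕ.≤-reflexive (sym e)))
  ... | b , c , b⊕c , Σb with sum≡1⇒unit c (ℕ.+-cancelˡ-≡ k _ _
    (trans (cong (ℕ._+ sum c) (sym Σb)) (trans (sym (sum-⊕ b c)) (trans (cong sum b⊕c) (trans e (ℕ.+-comm 1 k))))))
  ... | i , refl = subst (Generated basis)
    (cong₂ _,_ (trans (cong (pt 0 b ⊞_) (sym (pt-unit i))) (trans (sym (pt-⊕ 0 b (unit i))) (cong (pt 0) b⊕c)))
      (cong +_ (ℕ.+-comm k 1)))
    (generated-+ {H = basis} (generated-integral k b Σb) (generated-∈ {H = basis} (∈-++⁺ˡ (∈-tabulate⁺ {f = vertex} i))))

  generated-pt : ∀ s a → s ℕ.< j → Generated basis (pt s a , + (dg s ℕ.+ sum a))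
  generated-pt zero    a _         = generated-integral (sum a) a refl
  generated-pt (suc s) a (s≤s s<g) = subst (Generated basis)
    (cong (_, + (dg (suc s) ℕ.+ sum a)) (trans (sym (pt-⊕ (suc s) (replicate (suc d) 0) a)) (cong (pt (suc s)) (zipWith-identityˡ ℕ.+-identityˡ a))))
    (generated-+ {H = basis} (generated-∈ {H = basis} (subst (_∈ basis) box≡ (∈-++⁺ʳ (List.tabulate vertex) (∈-tabulate⁺ {f = box} t))))
      (generated-integral (sum a) a refl))
    where
    t = fromℕ< s<g
    box≡ : box t ≡ (pt (suc s) (replicate (suc d) 0) , + dg (suc s))
    box≡ = cong (λ s → pt (suc s) (replicate (suc d) 0) , + dg (suc s)) (toℕ-fromℕ< s<g)

  generated-isPt : ∀ x → (∃ λ k → deg x ≡ + k × IsPt (proj₁ x) k) → Generated basis x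
  generated-isPt (x , n) (k , n≡k , s , a , s<j , x≡pt , e) =
    subst (Generated basis) (cong₂ _,_ (sym x≡pt) (trans (cong +_ e) (sym n≡k))) (generated-pt s a s<j)

  basis-generates : GeneratesUsing (suc d) v basis (λ _ → ⊤)
  basis-generates = generated⇒GeneratesUsing v basis (λ x x∈ → generated-isPt x (inCone⇒pt (proj₁ x) (proj₂ x) x∈))

  basis-minimal : ∀ i → ¬ GeneratesUsing (suc d) v basis (λ k → k ≢ i)
  basis-minimal i gen = irreducibles-independent basis basis-unique basis-inC basis-≢0 basis-irreducible i
    (proj₁ generation) (proj₁ (proj₂ generation)) (proj₂ (proj₂ generation))
    where generation = gen (basis ‼ i) (inC⇒inCone (basis ‼ i) (basis-inC (∈-lookup i)))

  μ-hilb : MuHilb (suc d) v j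
  μ-hilb = basis , (((λ i → inC⇒inCone (basis ‼ i) (basis-inC (∈-lookup i))) , basis-generates) , basis-minimal) ,
    (index top , trans (cong deg (sym (lookup-index top))) (cong (λ s → + dg (suc s)) (toℕ-fromℕ< 1≤g))) ,
    (λ i → basis-degree (∈-lookup i))
    where
    -- Index 0, hence class 1 and degree `j`; it exists because `j ≥ 2`.
    top : box (fromℕ< 1≤g) ∈ basis
    top = ∈-++⁺ʳ (List.tabulate vertex) (∈-tabulate⁺ {f = box} (fromℕ< 1≤g))

  -- Ehrhart series

  -- Below degree `dg s` the shift supplies the empty list, where `n ∸ dg s` would wrongly give the
  -- representative.
  classPoints : ℕ → ℕ → List (Pt (suc d))
  classPoints s = shift List.[] (dg s) (λ m → List.map (pt s) (compositions (suc d) m))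

  points : ℕ → ℕ → List (Pt (suc d))
  points zero    n = classPoints 0 n
  points (suc s) n = points s n List.++ classPoints (suc s) n

  ∈-classPoints⁺ : ∀ s a → pt s a ∈ classPoints s (dg s ℕ.+ sum a)
  ∈-classPoints⁺ s a = ∈-shift⁺ (dg s) (∈-map⁺ (pt s) (∈-compositions⁺ a refl))

  ∈-classPoints⁻ : ∀ s {n x} → x ∈ classPoints s n → ∃ λ a → x ≡ pt s a × dg s ℕ.+ sum a ≡ n
  ∈-classPoints⁻ s x∈ with m , refl , x∈′ ← ∈-shift⁻ (dg s) x∈ with a , a∈ , refl ← ∈-map⁻ (pt s) x∈′ =
    a , refl , cong (dg s ℕ.+_) (∈-compositions⁻ a∈)

  ∈-points⁺ : ∀ S s a → s ℕ.≤ S → pt s a ∈ points S (dg s ℕ.+ sum a)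
  ∈-points⁺ zero    .0 a z≤n = ∈-classPoints⁺ 0 a
  ∈-points⁺ (suc S) s  a s≤ with ℕ.m≤n⇒m<n∨m≡n s≤
  ... | inj₁ (s≤s s≤S) = ∈-++⁺ˡ (∈-points⁺ S s a s≤S)
  ... | inj₂ refl      = ∈-++⁺ʳ (points S _) (∈-classPoints⁺ (suc S) a)

  ∈-points⁻ : ∀ S {n x} → x ∈ points S n → ∃ λ s → s ℕ.≤ S × ∃ λ a → x ≡ pt s a × dg s ℕ.+ sum a ≡ n
  ∈-points⁻ zero    x∈ = 0 , z≤n , ∈-classPoints⁻ 0 x∈
  ∈-points⁻ (suc S) {n} x∈ with ∈-++⁻ (points S n) x∈
  ... | inj₁ x∈ˡ with s , s≤S , r ← ∈-points⁻ S x∈ˡ = s , ℕ.m≤n⇒m≤1+n s≤S , r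
  ... | inj₂ x∈ʳ = suc S , ℕ.≤-refl , ∈-classPoints⁻ (suc S) x∈ʳ

  classPoints-unique : ∀ s n → Unique (classPoints s n)
  classPoints-unique s = shift-unique (dg s) (λ m → Unique.map⁺ (pt-injective {s}) (compositions-unique (suc d) m))

  points-unique : ∀ S n → S ℕ.< j → Unique (points S n)
  points-unique zero    n _   = classPoints-unique 0 n
  points-unique (suc S) n S<j = Unique.++⁺ (points-unique S n (ℕ.<⇒≤ S<j)) (classPoints-unique (suc S) n) disjoint
    where
    disjoint : ∀ {x} → ¬ (x ∈ points S n × x ∈ classPoints (suc S) n)
    disjoint (m₁ , m₂) with s , s≤S , a , refl , _ ← ∈-points⁻ S m₁ | b , e , _ ← ∈-classPoints⁻ (suc S) m₂ =
      ℕ.<⇒≢ (s≤s s≤S) (pt-class (ℕ.<-trans (s≤s s≤S) S<j) S<j e)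

  ehrhart : ℕ → ℕ
  ehrhart n = length (points g n)

  hasCard : ∀ n → HasCard (InDil (suc d) v n) (ehrhart n)
  hasCard n = points g n , refl , points-unique g n ℕ.≤-refl ,
    λ x → mk⇔ (λ h → to x (inDil⇒pt x n h)) (λ m → isPt⇒inDil x n (from x m))
    where
    to : ∀ x → IsPt x n → x ∈ points g n
    to x (s , a , s≤s s≤g , refl , refl) = ∈-points⁺ g s a s≤g
    from : ∀ x → x ∈ points g n → IsPt x n
    from x m with s , s≤g , a , p ← ∈-points⁻ g m = s , a , s≤s s≤g , p

  -- The coefficients of the sum of `t^(dg s)` over the classes up to the first argument.
  δPoly : ℕ → ℕ → ℤ
  δPoly zero    n = shift (+ 0) (dg 0) (count 0) n
  δPoly (suc s) n = δPoly s n ℤ.+ shift (+ 0) (dg (suc s)) (count 0) n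

  -- A class is a copy of ℕ^(d+1) moved up by `dg s`, with series `t^(dg s) / (1 - t)^(d+1)`.
  Δ^-classPoints : ∀ s → Δ^ (suc d) (λ n → + length (classPoints s n)) ≗ shift (+ 0) (dg s) (count 0)
  Δ^-classPoints s n = begin
    Δ^ (suc d) (λ n → + length (classPoints s n)) n
      ≡⟨ Δ^-cong (suc d) (λ n → trans (shift-hom (λ xs → + length xs) List.[] (dg s) _ n)
           (shift-cong (+ 0) (dg s) (λ m → cong +_ (length-map (pt s) (compositions (suc d) m))) n)) n ⟩
    Δ^ (suc d) (shift (+ 0) (dg s) (count (suc d))) n
      ≡⟨ Δ^-shift (suc d) (dg s) (count (suc d)) n ⟩
    shift (+ 0) (dg s) (Δ^ (suc d) (count (suc d))) n
      ≡⟨ shift-cong (+ 0) (dg s) (Δ^-count (suc d)) n ⟩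
    shift (+ 0) (dg s) (count 0) n ∎
    where open ≡-Reasoning

  Δ^-points : ∀ S → Δ^ (suc d) (λ n → + length (points S n)) ≗ δPoly S
  Δ^-points zero    n = Δ^-classPoints 0 n
  Δ^-points (suc S) n = trans (Δ^-cong (suc d) (λ n → cong +_ (length-++ (points S n))) n)
    (trans (Δ^-+ (suc d) (λ n → + length (points S n)) (λ n → + length (classPoints (suc S) n)) n)
      (cong₂ ℤ._+_ (Δ^-points S n) (Δ^-classPoints (suc S) n)))

  δPoly-above : ∀ S n → j ℕ.< n → δPoly S n ≡ + 0
  δPoly-above zero    n j<n = shift-count-≢ 0 n (ℕ.<⇒≢ (ℕ.≤-<-trans z≤n j<n))
  δPoly-above (suc S) n j<n = cong₂ ℤ._+_ (δPoly-above S n j<n)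
    (shift-count-≢ (dg (suc S)) n (ℕ.<⇒≢ (ℕ.≤-<-trans (dg≤j (suc S)) j<n)))

  -- Only class 1 has degree `j`: class 0 has degree 0, and later classes have smaller degree than
  -- class 1.
  δPoly-top : ∀ S → suc S ℕ.≤ j → δPoly (suc S) j ≡ + 1
  δPoly-top zero    _   = cong₂ ℤ._+_ (shift-count-≢ 0 j (λ ())) (shift-count-≡ j)
  δPoly-top (suc S) S≤j = cong₂ ℤ._+_ (δPoly-top S (ℕ.<⇒≤ S≤j))
    (shift-count-≢ (dg (suc (suc S))) j (ℕ.<⇒≢ (s≤s (ℕ.m∸n≤m g S))))

  μ-ehr : MuEhr d (suc d) v j
  μ-ehr = ehrhart , hasCard , s≤s z≤n , j≤d ,
    (λ e → case trans (sym (top g 1≤g ℕ.≤-refl)) (trans (sym (Δ^-points g j)) (trans (sym (δ≡Δ^ d ehrhart j)) e)) of λ ()) ,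
    (λ i j<i _ → trans (δ≡Δ^ d ehrhart i) (trans (Δ^-points g i) (δPoly-above g i j<i)))
    where
    top : ∀ g′ → 1 ℕ.≤ g′ → g′ ℕ.≤ g → δPoly g′ j ≡ + 1
    top (suc S) _ h = δPoly-top S (ℕ.m≤n⇒m≤1+n h)

-- Choice of `w` and conclusion

zero-one-vector : ∀ {m n} → m ≤ n → ∃ λ (ω : Vec ℕ n) → (∀ i → ω ! i ≤ 1) × sum ω ≡ m
zero-one-vector {n = n} z≤n = replicate n 0 ,
  (λ i → ℕ.≤-trans (ℕ.≤-reflexive (lookup-replicate i 0)) z≤n) , sum-replicate-0 n
zero-one-vector (s≤s m≤n) with ω , ω≤1 , Σω ← zero-one-vector m≤n =
  1 ∷ ω , (λ { zero → s≤s z≤n ; (suc i) → ω≤1 i }) , cong suc Σω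

theorem2p1 : (d j : ℕ) → 3 ≤ d → 2 ≤ j → j ≤ d ∸ 1 →
    Σ ℕ λ N → Σ (Fin (suc d) → Pt N) λ v →
    Simplex d v × EmptyPoly (suc d) v ×
    MuVa (suc d) v j × MuMidp (suc d) v j × MuIdp (suc d) v j ×
    MuHilb (suc d) v j × MuHole d (suc d) v j × MuEhr d (suc d) v j
theorem2p1 (suc d) (suc g) 3≤d (s≤s 1≤g) j≤d
  -- The `j + 1` ones must fit among the `d` entries of `w`, which is the bound `j ≤ d ∸ 1`.
  with ω , ω≤1 , Σω ← zero-one-vector (s≤s j≤d) =
  suc (suc d) , v , v-simplex , v-empty , μ-va , μ-midp , μ-idp , μ-hilb , μ-hole , μ-ehr
  where open ExtremalSimplex (suc d) g ω ω≤1 Σω 1≤g (ℕ.m≤n⇒m≤1+n j≤d)
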